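{- Let $r\geq 2$, $t\geq 1$, $n,k$ be positive integers with $n\geq\max\left\{2k,\ \frac{t(t-1)}{2\log 2}+2t-1\right\}$ and $t\leq 2^{r-2}\log 2-2$ ($\log$ the natural logarithm). Then \[ m(n,k,r,t)=\binom{n-t}{k-t}. \] Moreover, if $\mathcal{F}\subset\binom{[n]}{k}$ is $r$-wise $t$-intersecting with $|\mathcal{F}|=\binom{n-t}{k-t}$, then $\mathcal{F}$ is a full $t$-star, i.e. $\mathcal{F}=\{F\in\binom{[n]}{k}:T\subset F\}$ for some $t$-element set $T\subset[n]$.
   Context: $\binom{[n]}{k}$ is the set of $k$-element subsets of $[n]=\{1,\dots,n\}$. A family $\mathcal{F}$ is $r$-wise $t$-intersecting if $|F_1\cap\dots\cap F_r|\geq t$ for all (not necessarily distinct) $F_1,\dots,F_r\in\mathcal{F}$. $m(n,k,r,t)$ is the maximum of $|\mathcal{F}|$ over all $r$-wise $t$-intersecting families $\mathcal{F}\subset\binom{[n]}{k}$. -}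

module Defs where

open import Data.Nat using (ℕ; zero; suc; _+_; _*_; _∸_; _^_; _≤_; _≤ᵇ_)
open import Data.Nat.Combinatorics using (_C_)
open import Data.Nat.Base using (_!)
open import Data.Bool using (if_then_else_)
open import Data.Fin using (Fin)
open import Data.Fin.Subset using (Subset; _∩_; ⊤; ∣_∣; _⊆_)
open import Data.List using (List; length)
open import Data.List.Membership.Propositional using (_∈_)
open import Data.List.Relation.Unary.All using (All)
open import Data.List.Relation.Unary.Unique.Propositional using (Unique)
open import Data.Product using (Σ; _×_; ∃)
open import Relation.Binary.PropositionalEquality using (_≡_)
open import Function.Bundles using (_⇔_)

-- The natural logarithm of 2 without reals.
--
-- expSum a N = N! * Σ_{j=0}^{N} a^j / j!   (a natural number)
-- For natural a, b:   a ≤ b · log 2   ⇔   e^a ≤ 2^b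
--                                      ⇔   ∀ N, Σ_{j≤N} a^j/j! ≤ 2^b
--                                      ⇔   ∀ N, expSum a N ≤ 2^b * N!
-- (the partial sums of the exponential series increase to e^a).

expSum : ℕ → ℕ → ℕ
expSum a zero    = 1
expSum a (suc N) = suc N * expSum a N + a ^ suc N

LeMulLog2 : ℕ → ℕ → Set
LeMulLog2 a b = ∀ N → expSum a N ≤ 2 ^ b * N !

⋂ᵣ : ∀ {n} r → (Fin r → Subset n) → Subset n
⋂ᵣ zero    G = ⊤
⋂ᵣ (suc r) G = G Fin.zero ∩ ⋂ᵣ r (λ i → G (Fin.suc i))

IsFamily : (n k : ℕ) → List (Subset n) → Set
IsFamily n k 𝓕 = Unique 𝓕 × All (λ F → ∣ F ∣ ≡ k) 𝓕

-- r-wise t-intersecting (F_i not necessarily distinct)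
RWiseTIntersecting : ∀ {n} (r t : ℕ) → List (Subset n) → Set
RWiseTIntersecting {n} r t 𝓕 =
  (G : Fin r → Subset n) → (∀ i → G i ∈ 𝓕) → t ≤ ∣ ⋂ᵣ r G ∣

IsMaxSize : (n k r t m : ℕ) → Set
IsMaxSize n k r t m =
  Σ (List (Subset n)) (λ 𝓕 → IsFamily n k 𝓕 × RWiseTIntersecting r t 𝓕 × length 𝓕 ≡ m)
  × ((𝓕 : List (Subset n)) → IsFamily n k 𝓕 → RWiseTIntersecting r t 𝓕 → length 𝓕 ≤ m)

-- binom(n-t, k-t), with the usual convention that it is 0 when k < t
starSize : ℕ → ℕ → ℕ → ℕ
starSize n k t = if t ≤ᵇ k then (n ∸ t) C (k ∸ t) else 0

IsFullTStar : ∀ {n} (k t : ℕ) → List (Subset n) → Set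
IsFullTStar {n} k t 𝓕 =
  Σ (Subset n) (λ T → ∣ T ∣ ≡ t × ((S : Subset n) → (S ∈ 𝓕) ⇔ (∣ S ∣ ≡ k × T ⊆ S)))

{-# OPTIONS --safe #-}
{-
If some r - 1 members of an r-wise t-intersecting family meet in only t elements, then every member
contains these t elements. Hence a family whose members do not all contain a common t-set is
(r-1)-wise (t+1)-intersecting, and, once more, s-wise u-intersecting with s = r - 2, u = t + 2.

Such a family is smaller than a t-star. Shift it towards the first element. The members that contain
this element then form an s-wise (u-1)-intersecting family on the remaining elements, and those
that avoid it an s-wise (u+s-1)-intersecting one: s - 1 of any s sets of the latter can be
exchanged for sets which each lose an element of the intersection. Iterating, the count is that of
a walk from u which steps by -1 or by s - 1 until it hits 0. A walk with i steps up leaves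
C(n-u-si, k-u-(s-1)i) sets, which is at most C(n-t, k-t) / 2^(2+si) since 2k ≤ n; so the family has
at most x^u 2^t C(n-t, k-t) members whenever 1/2 + x^s/2 ≤ x. With q = 2^(s-1), x = (1+q)/(2q) is
such a number, and (1 + 1/q)^{qu} < e^u ≤ 4^q gives x^u 2^t < 1.
-}
module Submission where

open import Defs
open import Data.Nat using (ℕ; suc; _+_; _*_; _∸_; _^_; _≤_)
open import Data.Fin.Subset using (Subset)
open import Data.List using (List; length)
open import Data.Product using (_×_)
open import Relation.Binary.PropositionalEquality using (_≡_)
open import Data.Bool using (Bool; T; true; false; _∧_; _∨_; not; if_then_else_)
import Data.Bool.Properties as Bool
open import Data.Empty using (⊥; ⊥-elim)
open import Data.Fin using (Fin; zero; suc)
open import Data.Fin.Subset using (_∩_; ∣_∣; _⊆_) renaming (⊤ to full; ⊥ to empty)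
open import Data.Fin.Subset.Properties using (∣p∩q∣≤∣p∣; ∣p∩q∣≤∣q∣; ∣p∣≤∣x∷p∣; ∣p∣≤n; ∣⊥∣≡0; ∣⊤∣≡n; p⊆q⇒∣p∣≤∣q∣; p⊂q⇒∣p∣<∣q∣; p∩q⊆p; p∩q⊆q; ∩-assoc; ⊥⊆; out⊆; s⊆s; drop-∷-⊆; ∈⊤; x∈p∩q⁺; _⊆?_; _∈?_)
open import Data.List using ([]; _∷_; _++_; map; cartesianProductWith; allFin)
open import Data.List.Properties using (length-map; length-++)
open import Data.List.Membership.Propositional using (_∈_; find)
open import Data.List.Membership.Propositional.Properties using (∈-allFin; ∈-map⁻; ∈-++⁻; ∈-cartesianProductWith⁺; ∈-cartesianProductWith⁻)
open import Data.List.Relation.Unary.All using (All; []; _∷_; all?) renaming (lookup to All-lookup; tabulate to All-tabulate; zipWith to All-zipWith; map to All-map)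
open import Data.List.Relation.Unary.All.Properties using (¬All⇒Any¬; ¬Any⇒All¬)
open import Data.List.Relation.Unary.AllPairs using ([]; _∷_)
open import Data.List.Relation.Unary.Any using (here; there)
open import Data.List.Relation.Unary.Unique.Propositional using (Unique)
import Data.List.Relation.Unary.Unique.Propositional.Properties as Unique
open import Data.Nat hiding (_≟_)
open import Data.Nat.Properties
open import Data.Nat.Combinatorics using (_C_; nCk≡nC[n∸k]; nCn≡1; k>n⇒nCk≡0; nCk+nC[k+1]≡[n+1]C[k+1])
open import Data.Nat.Tactic.RingSolver using (solve-∀)
open import Data.Product using (_,_; ∃; proj₁; proj₂)
open import Data.Sum using (_⊎_; inj₁; inj₂)
open import Data.Vec using ([]; _∷_; lookup; _[_]≔_; tail)
open import Data.Vec.Properties using (lookup∘update; lookup∘update′; lookup-zipWith; lookup-replicate; []=⇒lookup; lookup⇒[]=; ≡-dec; ∷-injectiveʳ)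
open import Function using (_∘_; mk⇔)
open import Relation.Binary.PropositionalEquality
open import Relation.Nullary using (Dec; does; yes; no; ¬_; contradiction; _×-dec_)
open import Relation.Nullary.Decidable using (dec-true)

^-distribʳ-* : ∀ o m n → (m * n) ^ o ≡ m ^ o * n ^ o
^-distribʳ-* zero    m n = refl
^-distribʳ-* (suc o) m n =
  trans (cong (m * n *_) (^-distribʳ-* o m n)) ([m*n]*[o*p]≡[m*o]*[n*p] m n (m ^ o) (n ^ o))

-- Binomial coefficients

nC0≡1 : ∀ n → n C 0 ≡ 1
nC0≡1 n = trans (nCk≡nC[n∸k] {0} {n} z≤n) (nCn≡1 n)

[k+1]*[n+1]C[k+1]≡[n+1]*nCk : ∀ n k → suc k * (suc n C suc k) ≡ suc n * (n C k)
[k+1]*[n+1]C[k+1]≡[n+1]*nCk zero zero = refl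
[k+1]*[n+1]C[k+1]≡[n+1]*nCk zero (suc k) =
  trans (cong (suc (suc k) *_) (k>n⇒nCk≡0 {1} {suc (suc k)} (s≤s (s≤s z≤n)))) (*-zeroʳ (suc (suc k)))
[k+1]*[n+1]C[k+1]≡[n+1]*nCk (suc n) zero = begin
  1 * (suc (suc n) C 1)           ≡⟨ cong (1 *_) (nCk+nC[k+1]≡[n+1]C[k+1] (suc n) 0) ⟨
  1 * (suc n C 0 + suc n C 1)     ≡⟨ *-distribˡ-+ 1 (suc n C 0) (suc n C 1) ⟩
  1 * (suc n C 0) + 1 * (suc n C 1) ≡⟨ cong₂ _+_ (cong (1 *_) (nC0≡1 (suc n))) ([k+1]*[n+1]C[k+1]≡[n+1]*nCk n 0) ⟩
  1 + suc n * (n C 0)             ≡⟨ cong (λ z → 1 + suc n * z) (nC0≡1 n) ⟩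
  suc (suc n) * 1                 ≡⟨ cong (suc (suc n) *_) (nC0≡1 (suc n)) ⟨
  suc (suc n) * (suc n C 0)       ∎
  where open ≡-Reasoning
[k+1]*[n+1]C[k+1]≡[n+1]*nCk (suc n) (suc k) = begin
  suc (suc k) * (suc (suc n) C suc (suc k))
    ≡⟨ cong (suc (suc k) *_) (nCk+nC[k+1]≡[n+1]C[k+1] (suc n) (suc k)) ⟨
  suc (suc k) * (a + suc n C suc (suc k))
    ≡⟨ expand k a (suc n C suc (suc k)) ⟩
  suc k * a + suc (suc k) * (suc n C suc (suc k)) + a
    ≡⟨ cong (_+ a) (cong₂ _+_ ([k+1]*[n+1]C[k+1]≡[n+1]*nCk n k) ([k+1]*[n+1]C[k+1]≡[n+1]*nCk n (suc k))) ⟩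
  suc n * (n C k) + suc n * (n C suc k) + a
    ≡⟨ cong (_+ a) (*-distribˡ-+ (suc n) (n C k) (n C suc k)) ⟨
  suc n * (n C k + n C suc k) + a
    ≡⟨ cong (λ z → suc n * z + a) (nCk+nC[k+1]≡[n+1]C[k+1] n k) ⟩
  suc n * a + a
    ≡⟨ +-comm (suc n * a) a ⟩
  suc (suc n) * a ∎
  where
  open ≡-Reasoning
  a = suc n C suc k
  expand : ∀ k a b → suc (suc k) * (a + b) ≡ suc k * a + suc (suc k) * b + a
  expand = solve-∀

-- Pascal's rule with the previous identity cancelled from it. The upper index is written `k + d`,
-- so that n - k is `d` and needs no truncated subtraction.
[d+1]*[k+d+1]Ck≡[k+d+1]*[k+d]Ck : ∀ k d → suc d * (suc (k + d) C k) ≡ suc (k + d) * ((k + d) C k)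
[d+1]*[k+d+1]Ck≡[k+d+1]*[k+d]Ck zero d =
  cong (suc d *_) (trans (nC0≡1 (suc d)) (sym (nC0≡1 d)))
[d+1]*[k+d+1]Ck≡[k+d+1]*[k+d]Ck (suc k) d = +-cancelˡ-≡ (suc k * x) _ _ (begin
  suc k * x + suc d * x               ≡⟨ *-distribʳ-+ x (suc k) (suc d) ⟨
  (suc k + suc d) * x                 ≡⟨ cong (_* x) (+-suc (suc k) d) ⟩
  suc n * x                           ≡⟨ cong (suc n *_) (nCk+nC[k+1]≡[n+1]C[k+1] n k) ⟨
  suc n * (n C k + n C suc k)         ≡⟨ *-distribˡ-+ (suc n) (n C k) (n C suc k) ⟩
  suc n * (n C k) + suc n * (n C suc k) ≡⟨ cong (_+ suc n * (n C suc k)) ([k+1]*[n+1]C[k+1]≡[n+1]*nCk n k) ⟨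
  suc k * x + suc n * (n C suc k)     ∎)
  where
  open ≡-Reasoning
  n = suc k + d
  x = suc n C suc k

nCk>0 : ∀ {n k} → k ≤ n → 0 < n C k
nCk>0 {n} {zero} _ = ≤-reflexive (sym (nC0≡1 n))
nCk>0 {suc n} {suc k} (s≤s k≤n) =
  ≤-trans (nCk>0 k≤n) (≤-trans (m≤m+n _ _) (≤-reflexive (nCk+nC[k+1]≡[n+1]C[k+1] n k)))

-- The quotient of the two coefficients is (n+1)/(k+1).
2*nCk≤[n+1]C[k+1] : ∀ n k → 2 * suc k ≤ suc n → 2 * (n C k) ≤ suc n C suc k
2*nCk≤[n+1]C[k+1] n k h = *-cancelˡ-≤ (suc k) (begin
  suc k * (2 * (n C k))   ≡⟨ swap (suc k) (n C k) ⟩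
  2 * suc k * (n C k)     ≤⟨ *-monoˡ-≤ (n C k) h ⟩
  suc n * (n C k)         ≡⟨ [k+1]*[n+1]C[k+1]≡[n+1]*nCk n k ⟨
  suc k * (suc n C suc k) ∎)
  where
  open ≤-Reasoning
  swap : ∀ a b → a * (2 * b) ≡ 2 * a * b
  swap = solve-∀

-- The quotient (n+3)(n+2)(n+1) / ((k+2)(k+1)(n-k+1)) arises along C(n,k), C(n+1,k), C(n+2,k+1),
-- C(n+3,k+2). A single step with fixed k need not gain a factor 2; two steps that also raise k make
-- up for it.
8*nCk≤[n+3]C[k+2] : ∀ n k → suc (2 * (2 + k)) ≤ 3 + n → 8 * (n C k) ≤ (3 + n) C (2 + k)
8*nCk≤[n+3]C[k+2] n k h with m≤n⇒∃[o]m+o≡n h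
... | e , 2k+5+e≡n+3 = subst (λ n → 8 * (n C k) ≤ (3 + n) C (2 + k)) m≡n (*-cancelˡ-≤ w (begin
  w * (8 * c)                                 ≡⟨ lhs k d c ⟩
  8 * ((2 + k) * suc k * suc d) * c           ≤⟨ *-monoˡ-≤ c poly ⟩
  (3 + m) * (2 + m) * (1 + m) * c             ≡⟨ *-assoc ((3 + m) * (2 + m)) (1 + m) c ⟩
  (3 + m) * (2 + m) * ((1 + m) * c)           ≡⟨ cong ((3 + m) * (2 + m) *_) ([d+1]*[k+d+1]Ck≡[k+d+1]*[k+d]Ck k d) ⟨
  (3 + m) * (2 + m) * (suc d * c₁)            ≡⟨ shuffle (3 + m) (2 + m) (suc d) c₁ ⟩
  suc d * (3 + m) * ((2 + m) * c₁)            ≡⟨ cong (suc d * (3 + m) *_) ([k+1]*[n+1]C[k+1]≡[n+1]*nCk (suc m) k) ⟨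
  suc d * (3 + m) * (suc k * c₂)              ≡⟨ shuffle (suc d) (3 + m) (suc k) c₂ ⟩
  suc k * suc d * ((3 + m) * c₂)              ≡⟨ cong (suc k * suc d *_) ([k+1]*[n+1]C[k+1]≡[n+1]*nCk (2 + m) (suc k)) ⟨
  suc k * suc d * ((2 + k) * c₃)              ≡⟨ final (suc k) (suc d) (2 + k) c₃ ⟩
  w * c₃                                      ∎))
  where
  open ≤-Reasoning
  d = 2 + k + e
  m = k + d
  m≡n : m ≡ n
  m≡n = +-cancelˡ-≡ 3 m n (trans (rearrange k e) 2k+5+e≡n+3)
    where
    rearrange : ∀ k e → 3 + (k + (2 + k + e)) ≡ suc (2 * (2 + k)) + e
    rearrange = solve-∀
  c = m C k
  c₁ = suc m C k
  c₂ = (2 + m) C suc k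
  c₃ = (3 + m) C (2 + k)
  w = (2 + k) * suc k * suc d
  lhs : ∀ k d c → (2 + k) * suc k * suc d * (8 * c) ≡ 8 * ((2 + k) * suc k * suc d) * c
  lhs = solve-∀
  shuffle : ∀ a b x y → a * b * (x * y) ≡ x * a * (b * y)
  shuffle = solve-∀
  final : ∀ a b x y → a * b * (x * y) ≡ x * a * b * y
  final = solve-∀
  -- With `m` = 2k+2+e, the difference of the two sides is a polynomial in `k` and `e` with
  -- non-negative coefficients.
  poly : 8 * ((2 + k) * suc k * suc d) ≤ (3 + m) * (2 + m) * (1 + m)
  poly = m+n≤o⇒m≤o _ (≤-reflexive (identity k e))
    where
    identity : ∀ k e → 8 * ((2 + k) * suc k * suc (2 + k + e)) + (12 + 6 * k + 31 * e + 24 * k * e + 4 * k * k * e + 12 * e * e + 6 * k * e * e + e * e * e)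
             ≡ (3 + (k + (2 + k + e))) * (2 + (k + (2 + k + e))) * (1 + (k + (2 + k + e)))
    identity = solve-∀

-- The way from (n, k) to (n+a+b, k+a) consists of `b` blocks (3, 2), each worth a factor 8, and `e`
-- = a - 2b steps (1, 1), each worth a factor 2. They are peeled off from the upper end, and 2K < N
-- survives each removal.
2^[a+b]*nCk≤[n+a+b]C[k+a] : ∀ e b {a} → a ≡ 2 * b + e → ∀ n k → suc (2 * (a + k)) ≤ a + b + n →
  2 ^ (a + b) * (n C k) ≤ (a + b + n) C (a + k)
2^[a+b]*nCk≤[n+a+b]C[k+a] zero zero refl n k h = ≤-reflexive (*-identityˡ (n C k))
2^[a+b]*nCk≤[n+a+b]C[k+a] (suc e) zero refl n k h = begin
  2 * 2 ^ (e + 0) * (n C k)          ≡⟨ *-assoc 2 (2 ^ (e + 0)) (n C k) ⟩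
  2 * (2 ^ (e + 0) * (n C k))        ≤⟨ *-monoʳ-≤ 2 (2^[a+b]*nCk≤[n+a+b]C[k+a] e zero refl n k h′) ⟩
  2 * ((e + 0 + n) C (e + k))        ≤⟨ 2*nCk≤[n+1]C[k+1] (e + 0 + n) (e + k) (<⇒≤ h) ⟩
  suc (e + 0 + n) C suc (e + k)      ∎
  where
  open ≤-Reasoning
  h′ : suc (2 * (e + k)) ≤ e + 0 + n
  h′ = s≤s⁻¹ (≤-trans (m≤m+n _ 1) (≤-trans (≤-reflexive (rearrange (e + k))) h))
    where
    rearrange : ∀ x → suc (suc (2 * x)) + 1 ≡ suc (2 * suc x)
    rearrange = solve-∀
2^[a+b]*nCk≤[n+a+b]C[k+a] e (suc b) a≡2[b+1]+e n k h
  with refl ← trans a≡2[b+1]+e (cong (λ z → suc z + e) (+-suc b (b + 0)))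
  rewrite +-suc (2 * b + e) b = begin
  2 * (2 * (2 * 2 ^ (a + b))) * (n C k)  ≡⟨ collect (2 ^ (a + b)) (n C k) ⟩
  8 * (2 ^ (a + b) * (n C k))            ≤⟨ *-monoʳ-≤ 8 (2^[a+b]*nCk≤[n+a+b]C[k+a] e b refl n k h′) ⟩
  8 * ((a + b + n) C (a + k))            ≤⟨ 8*nCk≤[n+3]C[k+2] (a + b + n) (a + k) h ⟩
  (3 + (a + b + n)) C (2 + (a + k))      ∎
  where
  open ≤-Reasoning
  a = 2 * b + e
  collect : ∀ x c → 2 * (2 * (2 * x)) * c ≡ 8 * (x * c)
  collect = solve-∀
  h′ : suc (2 * (a + k)) ≤ a + b + n
  h′ = +-cancelˡ-≤ 3 _ _ (≤-trans (m≤m+n _ 1) (≤-trans (≤-reflexive (rearrange (a + k))) h))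
    where
    rearrange : ∀ x → 3 + suc (2 * x) + 1 ≡ suc (2 * (2 + x))
    rearrange = solve-∀

-- The exponential series

expSum-mono-≤ : ∀ {a b} → a ≤ b → ∀ N → expSum a N ≤ expSum b N
expSum-mono-≤ a≤b zero = ≤-refl
expSum-mono-≤ a≤b (suc N) = +-mono-≤ (*-monoʳ-≤ (suc N) (expSum-mono-≤ a≤b N)) (^-monoˡ-≤ (suc N) a≤b)

falling : ℕ → ℕ → ℕ
falling m       zero    = 1
falling zero    (suc j) = 0
falling (suc m) (suc j) = suc m * falling m j

falling≤m^j : ∀ m j → falling m j ≤ m ^ j
falling≤m^j m zero = ≤-refl
falling≤m^j zero (suc j) = z≤n
falling≤m^j (suc m) (suc j) =
  *-monoʳ-≤ (suc m) (≤-trans (falling≤m^j m j) (^-monoˡ-≤ j (n≤1+n m)))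

falling-suc : ∀ m j → falling (suc m) (suc j) ≡ falling m (suc j) + suc j * falling m j
falling-suc zero    zero    = refl
falling-suc zero    (suc j) = sym (*-zeroʳ (suc (suc j)))
falling-suc (suc m) zero    = identity m
  where
  identity : ∀ m → (2 + m) * 1 ≡ (1 + m) * 1 + 1 * 1
  identity = solve-∀
falling-suc (suc m) (suc j) = begin
  (2 + m) * falling (suc m) (suc j)        ≡⟨⟩
  p + suc m * p                            ≡⟨ cong (λ z → p + suc m * z) (falling-suc m j) ⟩
  p + suc m * (a + suc j * b)              ≡⟨ identity m j a b ⟩
  suc m * a + (2 + j) * p                  ∎
  where
  open ≡-Reasoning
  p = falling (suc m) (suc j)
  a = falling m (suc j)
  b = falling m j
  identity : ∀ m j a b → suc m * b + suc m * (a + suc j * b) ≡ suc m * a + (2 + j) * (suc m * b)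
  identity = solve-∀

-- N! q^N times the sum of the terms C(m,j) / q^j with j ≤ N of the binomial expansion of (1 + 1/q)^m
binomialSum : ℕ → ℕ → ℕ → ℕ
binomialSum q m zero    = 1
binomialSum q m (suc N) = suc N * q * binomialSum q m N + falling m (suc N)

-- The truncated form of (1 + 1/q)^(m+1) = (1 + 1/q)^m + (1/q)(1 + 1/q)^m: the factor 1/q lowers the
-- order of the second sum by one.
binomialSum-pascal : ∀ q m N →
  binomialSum q (suc m) (suc N) ≡ binomialSum q m (suc N) + suc N * binomialSum q m N
binomialSum-pascal q m zero = trans (cong (1 * q * 1 +_) (falling-suc m 0)) (sym (+-assoc (1 * q * 1) _ _))
binomialSum-pascal q m (suc N) = begin
  (2 + N) * q * binomialSum q (suc m) (suc N) + falling (suc m) (2 + N)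
    ≡⟨ cong₂ (λ x y → (2 + N) * q * x + y) (binomialSum-pascal q m N) (falling-suc m (suc N)) ⟩
  (2 + N) * q * (x + suc N * y) + (z + (2 + N) * w)
    ≡⟨ regroup N q x y z w ⟩
  (2 + N) * q * x + z + (2 + N) * (suc N * q * y + w) ∎
  where
  open ≡-Reasoning
  x = binomialSum q m (suc N)
  y = binomialSum q m N
  z = falling m (2 + N)
  w = falling m (suc N)
  regroup : ∀ N q x y z w → (2 + N) * q * (x + suc N * y) + (z + (2 + N) * w)
                          ≡ (2 + N) * q * x + z + (2 + N) * (suc N * q * y + w)
  regroup = solve-∀

-- From order `m` on no term is missing, so this is the binomial theorem. The excess `e` varies in
-- the induction because Pascal's rule refers to two consecutive orders.
binomialSum-complete : ∀ q m e → binomialSum q m (m + e) ≡ (m + e) ! * q ^ e * suc q ^ m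
binomialSum-complete q zero zero = refl
binomialSum-complete q zero (suc e) =
  trans (cong (λ z → suc e * q * z + 0) (binomialSum-complete q zero e)) (regroup e q (e !) (q ^ e))
  where
  regroup : ∀ e q x y → suc e * q * (x * y * 1) + 0 ≡ suc e * x * (q * y) * 1
  regroup = solve-∀
binomialSum-complete q (suc m) e = begin
  binomialSum q (suc m) (suc (m + e))
    ≡⟨ binomialSum-pascal q m (m + e) ⟩
  binomialSum q m (suc (m + e)) + suc (m + e) * binomialSum q m (m + e)
    ≡⟨ cong (λ z → binomialSum q m z + suc (m + e) * binomialSum q m (m + e)) (+-suc m e) ⟨
  binomialSum q m (m + suc e) + suc (m + e) * binomialSum q m (m + e)
    ≡⟨ cong₂ (λ x y → x + suc (m + e) * y) (binomialSum-complete q m (suc e)) (binomialSum-complete q m e) ⟩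
  (m + suc e) ! * q ^ suc e * suc q ^ m + suc (m + e) * ((m + e) ! * q ^ e * suc q ^ m)
    ≡⟨ cong (λ z → z ! * q ^ suc e * suc q ^ m + suc (m + e) * ((m + e) ! * q ^ e * suc q ^ m)) (+-suc m e) ⟩
  suc (m + e) ! * q ^ suc e * suc q ^ m + suc (m + e) * ((m + e) ! * q ^ e * suc q ^ m)
    ≡⟨ regroup (suc (m + e)) ((m + e) !) q (q ^ e) (suc q ^ m) ⟩
  suc (m + e) ! * q ^ e * suc q ^ suc m ∎
  where
  open ≡-Reasoning
  regroup : ∀ s x q y z → s * x * (q * y) * z + s * (x * y * z) ≡ s * x * y * (suc q * z)
  regroup = solve-∀

-- Termwise, C(qu, j) / q^j is at most u^j / j!.
binomialSum≤q^N*expSum : ∀ q u N → binomialSum q (q * u) N ≤ q ^ N * expSum u N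
binomialSum≤q^N*expSum q u zero = ≤-refl
binomialSum≤q^N*expSum q u (suc N) = begin
  suc N * q * binomialSum q (q * u) N + falling (q * u) (suc N)
    ≤⟨ +-mono-≤ (*-monoʳ-≤ (suc N * q) (binomialSum≤q^N*expSum q u N)) (falling≤m^j (q * u) (suc N)) ⟩
  suc N * q * (q ^ N * expSum u N) + (q * u) ^ suc N
    ≡⟨ cong (suc N * q * (q ^ N * expSum u N) +_) (^-distribʳ-* (suc N) q u) ⟩
  suc N * q * (q ^ N * expSum u N) + q ^ suc N * u ^ suc N
    ≡⟨ regroup (suc N) q (q ^ N) (expSum u N) (u ^ suc N) ⟩
  q ^ suc N * (suc N * expSum u N + u ^ suc N) ∎
  where
  open ≤-Reasoning
  regroup : ∀ s q x y z → s * q * (x * y) + q * x * z ≡ q * x * (s * y + z)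
  regroup = solve-∀

-- For positive `a` each partial sum lies strictly below the next one, which still satisfies the
-- bound.
LeMulLog2-strict : ∀ {a b} → 1 ≤ a → LeMulLog2 a b → ∀ N → expSum a N < 2 ^ b * N !
LeMulLog2-strict {a} {b} 1≤a h N = *-cancelˡ-< (suc N) _ _ (begin-strict
  suc N * expSum a N                  <⟨ m<m+n (suc N * expSum a N) (m^n>0 a {{>-nonZero 1≤a}} (suc N)) ⟩
  suc N * expSum a N + a ^ suc N      ≤⟨ h (suc N) ⟩
  2 ^ b * (suc N * N !)               ≡⟨ regroup (2 ^ b) (suc N) (N !) ⟩
  suc N * (2 ^ b * N !)               ∎)
  where
  open ≤-Reasoning
  regroup : ∀ x y z → x * (y * z) ≡ y * (x * z)
  regroup = solve-∀

-- (1 + 1/q)^(qu) is at most the partial sum of e^u of order qu, hence less than 4^q.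
[1+q]^u<4*q^u : ∀ q u → 1 ≤ q → 1 ≤ u → LeMulLog2 u (2 * q) → suc q ^ u < 4 * q ^ u
[1+q]^u<4*q^u q u 1≤q 1≤u h = ≰⇒> λ 4q^u≤[1+q]^u → <-irrefl refl (begin-strict
  (4 * q ^ u) ^ q * N !        ≤⟨ *-monoˡ-≤ (N !) (^-monoˡ-≤ q 4q^u≤[1+q]^u) ⟩
  (suc q ^ u) ^ q * N !        ≡⟨ cong (_* N !) (trans (^-*-assoc (suc q) u q) (cong (suc q ^_) (*-comm u q))) ⟩
  suc q ^ N * N !              ≡⟨ *-comm (suc q ^ N) (N !) ⟩
  N ! * suc q ^ N              ≡⟨ cong (_* suc q ^ N) (*-identityʳ (N !)) ⟨
  N ! * 1 * suc q ^ N          ≡⟨ cong (λ z → z ! * 1 * suc q ^ N) (+-identityʳ N) ⟨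
  (N + 0) ! * 1 * suc q ^ N    ≡⟨ binomialSum-complete q N 0 ⟨
  binomialSum q N (N + 0)      ≡⟨ cong (binomialSum q N) (+-identityʳ N) ⟩
  binomialSum q N N            ≤⟨ binomialSum≤q^N*expSum q u N ⟩
  q ^ N * expSum u N           <⟨ *-monoʳ-< (q ^ N) {{m^n≢0 q N {{>-nonZero 1≤q}}}} (LeMulLog2-strict {u} {2 * q} 1≤u h N) ⟩
  q ^ N * (2 ^ (2 * q) * N !)  ≡⟨ *-assoc (q ^ N) (2 ^ (2 * q)) (N !) ⟨
  q ^ N * 2 ^ (2 * q) * N !    ≡⟨ cong₂ (λ x y → x * y * N !) q^N (sym (^-*-assoc 2 2 q)) ⟩
  (q ^ u) ^ q * 4 ^ q * N !    ≡⟨ cong (_* N !) (*-comm ((q ^ u) ^ q) (4 ^ q)) ⟩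
  4 ^ q * (q ^ u) ^ q * N !    ≡⟨ cong (_* N !) (^-distribʳ-* q 4 (q ^ u)) ⟨
  (4 * q ^ u) ^ q * N !        ∎)
  where
  open ≤-Reasoning
  N = q * u
  q^N : q ^ N ≡ (q ^ u) ^ q
  q^N = trans (cong (q ^_) (*-comm q u)) (sym (^-*-assoc q u q))

-- The condition on x for q = 2^(s-1)

-- The mean value estimate for the s-th power on the interval from q to q+1, where s is `suc m`.
[1+q]^s≤q^s+s*[1+q]^[s-1] : ∀ q m → suc q ^ suc m ≤ q ^ suc m + suc m * suc q ^ m
[1+q]^s≤q^s+s*[1+q]^[s-1] q zero = ≤-reflexive (identity q)
  where
  identity : ∀ q → suc q * 1 ≡ q * 1 + 1 * 1
  identity = solve-∀
[1+q]^s≤q^s+s*[1+q]^[s-1] q (suc m) = begin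
  x + q * x                                     ≤⟨ +-monoʳ-≤ x (*-monoʳ-≤ q ([1+q]^s≤q^s+s*[1+q]^[s-1] q m)) ⟩
  x + q * (q ^ suc m + suc m * suc q ^ m)       ≤⟨ m≤m+n _ (suc m * suc q ^ m) ⟩
  x + q * (q ^ suc m + suc m * suc q ^ m) + suc m * suc q ^ m
                                                ≡⟨ regroup q m (q ^ suc m) (suc q ^ m) ⟩
  q * q ^ suc m + (2 + m) * x                   ∎
  where
  open ≤-Reasoning
  x = suc q ^ suc m
  regroup : ∀ q m y z → suc q * z + q * (y + suc m * z) + suc m * z ≡ q * y + (2 + m) * (suc q * z)
  regroup = solve-∀

2*[4+m]≤2^[3+m] : ∀ m → 2 * (4 + m) ≤ 2 ^ (3 + m)
2*[4+m]≤2^[3+m] zero = ≤-refl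
2*[4+m]≤2^[3+m] (suc m) = begin
  2 * (5 + m)              ≤⟨ *-monoʳ-≤ 2 (m≤m+n (5 + m) (3 + m)) ⟩
  2 * (5 + m + (3 + m))    ≡⟨ regroup m ⟩
  2 * (2 * (4 + m))        ≤⟨ *-monoʳ-≤ 2 (2*[4+m]≤2^[3+m] m) ⟩
  2 * 2 ^ (3 + m)          ∎
  where
  open ≤-Reasoning
  regroup : ∀ m → 2 * (5 + m + (3 + m)) ≡ 2 * (2 * (4 + m))
  regroup = solve-∀

-- With s = 3 + m and q = 2^(s-1), this is 1/2 + x^s/2 ≤ x for x = (1+q)/(2q), cleared of
-- denominators. Doubling the mean value estimate leaves the error 2s(1+q)^(s-1), which (1+q)^s
-- absorbs once 2s ≤ 1+q.
[1+2^s]^[1+s]≤2*[2^s]^[1+s] : ∀ m → suc (2 ^ (2 + m)) ^ (3 + m) ≤ 2 * (2 ^ (2 + m)) ^ (3 + m)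
-- For s = 3 and q = 4 the inequality 2s ≤ 1+q fails, and the numbers are compared directly.
[1+2^s]^[1+s]≤2*[2^s]^[1+s] zero = ≤ᵇ⇒≤ 125 128 _
[1+2^s]^[1+s]≤2*[2^s]^[1+s] (suc m) = +-cancelʳ-≤ x x (2 * q ^ s) (begin
  x + x                                    ≡⟨ cong (x +_) (+-identityʳ x) ⟨
  2 * x                                    ≤⟨ *-monoʳ-≤ 2 ([1+q]^s≤q^s+s*[1+q]^[s-1] q (3 + m)) ⟩
  2 * (q ^ s + s * suc q ^ (3 + m))        ≡⟨ regroup (q ^ s) s (suc q ^ (3 + m)) ⟩
  2 * q ^ s + 2 * s * suc q ^ (3 + m)      ≤⟨ +-monoʳ-≤ (2 * q ^ s) (*-monoˡ-≤ (suc q ^ (3 + m)) (m≤n⇒m≤1+n (2*[4+m]≤2^[3+m] m))) ⟩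
  2 * q ^ s + x                            ∎)
  where
  open ≤-Reasoning
  q = 2 ^ (3 + m)
  s = 4 + m
  x = suc q ^ s
  regroup : ∀ y s z → 2 * (y + s * z) ≡ 2 * y + 2 * s * z
  regroup = solve-∀

-- Families of subsets

-- Characteristic functions make the two slices at the first element mere compositions, on which
-- sizes and bounds are computed recursively.
Family : ℕ → Set
Family n = Subset n → Bool

size : ∀ {n} → Family n → ℕ
size {zero}  f = if f [] then 1 else 0
size {suc n} f = size (f ∘ (true ∷_)) + size (f ∘ (false ∷_))

Uniform : ∀ {n} → ℕ → Family n → Set
Uniform k f = ∀ F → f F ≡ true → ∣ F ∣ ≡ k

Intersecting : ∀ {n} → ℕ → ℕ → Family n → Set
Intersecting {n} s u f = (G : Fin s → Subset n) → (∀ i → f (G i) ≡ true) → u ≤ ∣ ⋂ᵣ s G ∣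

size-cong : ∀ {n} (f g : Family n) → (∀ F → f F ≡ g F) → size f ≡ size g
size-cong {zero}  f g f≗g rewrite f≗g [] = refl
size-cong {suc n} f g f≗g = cong₂ _+_ (size-cong _ _ (f≗g ∘ (true ∷_))) (size-cong _ _ (f≗g ∘ (false ∷_)))

size-empty : ∀ {n} (f : Family n) → (∀ F → f F ≡ true → ⊥) → size f ≡ 0
size-empty {zero} f f-empty with f [] in eq
... | true  = ⊥-elim (f-empty [] eq)
... | false = refl
size-empty {suc n} f f-empty =
  cong₂ _+_ (size-empty _ (f-empty ∘ (true ∷_))) (size-empty _ (f-empty ∘ (false ∷_)))

-- A shift exchanging the first two elements replaces two slices by their union and their
-- intersection; the order `g F ∧ f F` is the one in which `shift` produces the latter.
size-∨-∧ : ∀ {n} (f g : Family n) →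
  size (λ F → f F ∨ g F) + size (λ F → g F ∧ f F) ≡ size f + size g
size-∨-∧ {zero} f g with f [] | g []
... | true  | true  = refl
... | true  | false = refl
... | false | true  = refl
... | false | false = refl
size-∨-∧ {suc n} f g = begin
  (a₁ + a₀) + (b₁ + b₀)  ≡⟨ interchange a₁ a₀ b₁ b₀ ⟩
  (a₁ + b₁) + (a₀ + b₀)  ≡⟨ cong₂ _+_ (size-∨-∧ (f ∘ (true ∷_)) (g ∘ (true ∷_))) (size-∨-∧ (f ∘ (false ∷_)) (g ∘ (false ∷_))) ⟩
  (f₁ + g₁) + (f₀ + g₀)  ≡⟨ interchange f₁ g₁ f₀ g₀ ⟩
  (f₁ + f₀) + (g₁ + g₀)  ∎
  where
  open ≡-Reasoning
  a₁ = size (λ F → f (true ∷ F) ∨ g (true ∷ F))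
  a₀ = size (λ F → f (false ∷ F) ∨ g (false ∷ F))
  b₁ = size (λ F → g (true ∷ F) ∧ f (true ∷ F))
  b₀ = size (λ F → g (false ∷ F) ∧ f (false ∷ F))
  f₁ = size (f ∘ (true ∷_))
  f₀ = size (f ∘ (false ∷_))
  g₁ = size (g ∘ (true ∷_))
  g₀ = size (g ∘ (false ∷_))
  interchange : ∀ a b c d → (a + b) + (c + d) ≡ (a + c) + (b + d)
  interchange = solve-∀

uniform⇒size≤nCk : ∀ {n} k (f : Family n) → Uniform k f → size f ≤ n C k
uniform⇒size≤nCk {zero} zero f _ with f []
... | true  = ≤-refl
... | false = z≤n
uniform⇒size≤nCk {zero} (suc k) f uniform with f [] in eq
... | true  = contradiction (uniform [] eq) λ ()
... | false = z≤n
uniform⇒size≤nCk {suc n} zero f uniform = begin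
  size (f ∘ (true ∷_)) + size (f ∘ (false ∷_))
    ≡⟨ cong (_+ size (f ∘ (false ∷_))) (size-empty _ λ F eq → contradiction (uniform (true ∷ F) eq) λ ()) ⟩
  size (f ∘ (false ∷_))  ≤⟨ uniform⇒size≤nCk 0 _ (uniform ∘ (false ∷_)) ⟩
  n C 0                  ≡⟨ trans (nC0≡1 n) (sym (nC0≡1 (suc n))) ⟩
  suc n C 0              ∎
  where open ≤-Reasoning
uniform⇒size≤nCk {suc n} (suc k) f uniform = begin
  size (f ∘ (true ∷_)) + size (f ∘ (false ∷_))
    ≤⟨ +-mono-≤ (uniform⇒size≤nCk k _ λ F eq → suc-injective (uniform (true ∷ F) eq))
                (uniform⇒size≤nCk (suc k) _ (uniform ∘ (false ∷_))) ⟩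
  n C k + n C suc k      ≡⟨ nCk+nC[k+1]≡[n+1]C[k+1] n k ⟩
  suc n C suc k          ∎
  where open ≤-Reasoning

lookup-⋂ᵣ⁻ : ∀ {n} r (G : Fin r → Subset n) x → lookup (⋂ᵣ r G) x ≡ true → ∀ i → lookup (G i) x ≡ true
lookup-⋂ᵣ⁻ (suc r) G x x∈ i
  rewrite lookup-zipWith _∧_ x (G zero) (⋂ᵣ r (G ∘ suc)) with lookup (G zero) x in eq | i
... | true | zero  = eq
... | true | suc i = lookup-⋂ᵣ⁻ r (G ∘ suc) x x∈ i

lookup-⋂ᵣ⁺ : ∀ {n} r (G : Fin r → Subset n) x → (∀ i → lookup (G i) x ≡ true) → lookup (⋂ᵣ r G) x ≡ true
lookup-⋂ᵣ⁺ zero    G x x∈ = lookup-replicate x true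
lookup-⋂ᵣ⁺ (suc r) G x x∈
  rewrite lookup-zipWith _∧_ x (G zero) (⋂ᵣ r (G ∘ suc)) | x∈ zero = lookup-⋂ᵣ⁺ r (G ∘ suc) x (x∈ ∘ suc)

⋂ᵣ-true∷ : ∀ {n} r (G : Fin r → Subset n) → ⋂ᵣ r (λ i → true ∷ G i) ≡ true ∷ ⋂ᵣ r G
⋂ᵣ-true∷ zero    G = refl
⋂ᵣ-true∷ (suc r) G rewrite ⋂ᵣ-true∷ r (G ∘ suc) = refl

intersecting⇒u≤∣F∣ : ∀ {n m u} {f : Family n} → Intersecting (suc m) u f → ∀ F → f F ≡ true → u ≤ ∣ F ∣
intersecting⇒u≤∣F∣ {m = m} int F F∈f = ≤-trans (int (λ _ → F) (λ _ → F∈f)) (∣p∩q∣≤∣p∣ F (⋂ᵣ m (λ _ → F)))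

∣[x]≔true∣ : ∀ {n} (F : Subset n) x → lookup F x ≡ false → ∣ F [ x ]≔ true ∣ ≡ suc ∣ F ∣
∣[x]≔true∣ (false ∷ F) zero    eq = refl
∣[x]≔true∣ (true  ∷ F) (suc x) eq = cong suc (∣[x]≔true∣ F x eq)
∣[x]≔true∣ (false ∷ F) (suc x) eq = ∣[x]≔true∣ F x eq

∣[x]≔false∣ : ∀ {n} (F : Subset n) x → lookup F x ≡ true → suc ∣ F [ x ]≔ false ∣ ≡ ∣ F ∣
∣[x]≔false∣ (true  ∷ F) zero    eq = refl
∣[x]≔false∣ (true  ∷ F) (suc x) eq = cong suc (∣[x]≔false∣ F x eq)
∣[x]≔false∣ (false ∷ F) (suc x) eq = ∣[x]≔false∣ F x eq

-- Shifting towards the first element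

-- The usual compression, exchanging an element for the first one where the result is not yet
-- present; `x` indexes the remaining elements.
shift : ∀ {n} → Fin n → Family (suc n) → Family (suc n)
shift x f (true  ∷ F) = f (true ∷ F) ∨ (not (lookup F x) ∧ f (false ∷ F [ x ]≔ true))
shift x f (false ∷ F) = f (false ∷ F) ∧ (not (lookup F x) ∨ f (true ∷ F [ x ]≔ false))

size-shift : ∀ {n} (x : Fin n) f → size (shift x f) ≡ size f
size-shift {suc n} zero f = begin
  (size (shift zero f ∘ (true ∷_) ∘ (true ∷_)) + i₀) + (o₁ + size (shift zero f ∘ (false ∷_) ∘ (false ∷_)))
    ≡⟨ cong₂ (λ y z → (y + i₀) + (o₁ + z)) (size-cong (shift zero f ∘ (true ∷_) ∘ (true ∷_)) _ λ F → Bool.∨-identityʳ _)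
        (size-cong (shift zero f ∘ (false ∷_) ∘ (false ∷_)) _ λ F → Bool.∧-identityʳ _) ⟩
  (f₁₁ + i₀) + (o₁ + f₀₀)  ≡⟨ interchange f₁₁ i₀ o₁ f₀₀ ⟩
  f₁₁ + (i₀ + o₁) + f₀₀    ≡⟨ cong (λ z → f₁₁ + z + f₀₀) (size-∨-∧ (f ∘ (true ∷_) ∘ (false ∷_)) (f ∘ (false ∷_) ∘ (true ∷_))) ⟩
  f₁₁ + (f₁₀ + f₀₁) + f₀₀  ≡⟨ interchange f₁₁ f₁₀ f₀₁ f₀₀ ⟨
  (f₁₁ + f₁₀) + (f₀₁ + f₀₀) ∎
  where
  open ≡-Reasoning
  f₁₁ = size (f ∘ (true ∷_) ∘ (true ∷_))
  f₁₀ = size (f ∘ (true ∷_) ∘ (false ∷_))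
  f₀₁ = size (f ∘ (false ∷_) ∘ (true ∷_))
  f₀₀ = size (f ∘ (false ∷_) ∘ (false ∷_))
  i₀ = size (shift zero f ∘ (true ∷_) ∘ (false ∷_))
  o₁ = size (shift zero f ∘ (false ∷_) ∘ (true ∷_))
  interchange : ∀ a b c d → (a + b) + (c + d) ≡ a + (b + c) + d
  interchange = solve-∀
size-shift {suc n} (suc x) f = begin
  -- Once membership of the second element is fixed, the shift acts separately on the two slices.
  (i₁ + i₀) + (o₁ + o₀)  ≡⟨ interchange i₁ i₀ o₁ o₀ ⟩
  (i₁ + o₁) + (i₀ + o₀)  ≡⟨ cong₂ _+_ (size-shift x (slice true)) (size-shift x (slice false)) ⟩
  (size (slice true ∘ (true ∷_)) + size (slice true ∘ (false ∷_))) + (size (slice false ∘ (true ∷_)) + size (slice false ∘ (false ∷_)))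
                         ≡⟨ interchange (size (slice true ∘ (true ∷_))) _ _ _ ⟩
  size f                 ∎
  where
  open ≡-Reasoning
  slice : Bool → Family (suc n)
  slice b (a ∷ F) = f (a ∷ b ∷ F)
  i₁ = size (shift (suc x) f ∘ (true ∷_) ∘ (true ∷_))
  i₀ = size (shift (suc x) f ∘ (true ∷_) ∘ (false ∷_))
  o₁ = size (shift (suc x) f ∘ (false ∷_) ∘ (true ∷_))
  o₀ = size (shift (suc x) f ∘ (false ∷_) ∘ (false ∷_))
  interchange : ∀ a b c d → (a + b) + (c + d) ≡ (a + c) + (b + d)
  interchange = solve-∀

∈⇒∈shift : ∀ {n} x (f : Family (suc n)) F → f (true ∷ F) ≡ true → shift x f (true ∷ F) ≡ true
∈⇒∈shift x f F F∈f rewrite F∈f = refl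

∈shift⇒∈ : ∀ {n} x (f : Family (suc n)) F → shift x f (false ∷ F) ≡ true → f (false ∷ F) ≡ true
∈shift⇒∈ x f F F∈ with f (false ∷ F)
... | true = refl

-- A member of f from which F arises when f is shifted, except that a set false ∷ F containing x
-- is replaced by the set true ∷ F [ x ]≔ false which prevented it from being shifted.
unshift : ∀ {n} → Fin n → Family (suc n) → Subset (suc n) → Subset (suc n)
unshift x f (true  ∷ F) = if f (true ∷ F) then true ∷ F else false ∷ F [ x ]≔ true
unshift x f (false ∷ F) = if lookup F x then true ∷ F [ x ]≔ false else false ∷ F

unshift∈ : ∀ {n} x (f : Family (suc n)) F → shift x f F ≡ true → f (unshift x f F) ≡ true
unshift∈ x f (true ∷ F) F∈ with f (true ∷ F) in eq
... | true = eq
... | false with lookup F x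
...   | false = F∈
unshift∈ x f (false ∷ F) F∈ with f (false ∷ F) in eq | lookup F x
... | true | true  = F∈
... | true | false = eq

∣unshift∣ : ∀ {n} x (f : Family (suc n)) F → shift x f F ≡ true → ∣ unshift x f F ∣ ≡ ∣ F ∣
∣unshift∣ x f (true ∷ F) F∈ with f (true ∷ F)
... | true = refl
... | false with lookup F x in eq
...   | false = ∣[x]≔true∣ F x eq
∣unshift∣ x f (false ∷ F) F∈ with lookup F x in eq
... | true  = ∣[x]≔false∣ F x eq
... | false = refl

unshift-head : ∀ {n} x (f : Family (suc n)) F → shift x f F ≡ true →
  lookup (unshift x f F) zero ≡ true → f F ≡ true
unshift-head x f (true ∷ F) F∈ h with f (true ∷ F)
... | true = refl
unshift-head x f (false ∷ F) F∈ h = ∈shift⇒∈ x f F F∈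

unshift-lookup-x : ∀ {n} x (f : Family (suc n)) F →
  lookup (unshift x f F) (suc x) ≡ true → lookup F zero ≡ true
unshift-lookup-x x f (true ∷ F) h = refl
unshift-lookup-x x f (false ∷ F) h with lookup F x in eq
... | true  = trans (sym (lookup∘update x F false)) h
... | false = trans (sym eq) h

unshift-lookup : ∀ {n} x (f : Family (suc n)) F y → y ≢ x →
  lookup (unshift x f F) (suc y) ≡ lookup F (suc y)
unshift-lookup x f (true ∷ F) y y≢x with f (true ∷ F)
... | true  = refl
... | false = lookup∘update′ y≢x F true
unshift-lookup x f (false ∷ F) y y≢x with lookup F x
... | true  = lookup∘update′ y≢x F false
... | false = refl

⊆-lookup⇒∣∣≤ : ∀ {n} (P Q : Subset n) → (∀ y → lookup P y ≡ true → lookup Q y ≡ true) → ∣ P ∣ ≤ ∣ Q ∣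
⊆-lookup⇒∣∣≤ P Q P⊆Q = p⊆q⇒∣p∣≤∣q∣ {p = P} {Q} λ {y} y∈P → lookup⇒[]= y Q (P⊆Q y ([]=⇒lookup y∈P))

∣∷∣-mono : ∀ {m n} a b (P : Subset m) (Q : Subset n) → (a ≡ true → b ≡ true) → ∣ P ∣ ≤ ∣ Q ∣ → ∣ a ∷ P ∣ ≤ ∣ b ∷ Q ∣
∣∷∣-mono true  true  _ _ _   P≤Q = s≤s P≤Q
∣∷∣-mono true  false _ _ a⇒b P≤Q = contradiction (a⇒b refl) λ ()
∣∷∣-mono false true  _ _ _   P≤Q = m≤n⇒m≤1+n P≤Q
∣∷∣-mono false false _ _ _   P≤Q = P≤Q

∣∷∷∣-swap : ∀ {n} a b (P : Subset n) → ∣ a ∷ b ∷ P ∣ ≡ ∣ b ∷ a ∷ P ∣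
∣∷∷∣-swap true  true  P = refl
∣∷∷∣-swap true  false P = refl
∣∷∷∣-swap false true  P = refl
∣∷∷∣-swap false false P = refl

-- `P` injects into `h ∷ Q`: `x` goes to the new first element, every other element to itself.
⊆-transposition⇒∣∣≤ : ∀ {n} x (P Q : Subset n) h →
  (∀ y → y ≢ x → lookup P y ≡ true → lookup Q y ≡ true) → (lookup P x ≡ true → h ≡ true) → ∣ P ∣ ≤ ∣ h ∷ Q ∣
⊆-transposition⇒∣∣≤ zero (a ∷ P) (b ∷ Q) h P⊆Q x⇒h =
  ∣∷∣-mono a h P (b ∷ Q) x⇒h (≤-trans (⊆-lookup⇒∣∣≤ P Q λ y → P⊆Q (suc y) λ ()) (∣p∣≤∣x∷p∣ b Q))
⊆-transposition⇒∣∣≤ (suc x) (a ∷ P) (b ∷ Q) h P⊆Q x⇒h =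
  ≤-trans (∣∷∣-mono a b P (h ∷ Q) (P⊆Q zero λ ())
             (⊆-transposition⇒∣∣≤ x P Q h (λ y y≢x → P⊆Q (suc y) λ { refl → y≢x refl }) x⇒h))
          (≤-reflexive (∣∷∷∣-swap b h Q))

-- If all unshifted sets contain the first element, the given sets already belong to `f`. Otherwise
-- the unshifted sets meet in a set `P` without the first element. All elements of `P` but `x` lie
-- in all given sets, and if `x` is in `P`, the first element lies in all of them and replaces it.
shift-intersecting : ∀ {n s u} (x : Fin n) f → Intersecting s u f → Intersecting s u (shift x f)
shift-intersecting {s = s} {u} x f int G G∈ with ⋂ᵣ s (unshift x f ∘ G) in eq
... | true ∷ P = int G λ i → unshift-head x f (G i) (G∈ i)
  (lookup-⋂ᵣ⁻ s (unshift x f ∘ G) zero (cong (λ Q → lookup Q zero) eq) i)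
... | false ∷ P with ⋂ᵣ s G in eq′
...   | h ∷ Q = ≤-trans (subst (λ R → u ≤ ∣ R ∣) eq (int (unshift x f ∘ G) λ i → unshift∈ x f (G i) (G∈ i)))
  (⊆-transposition⇒∣∣≤ x P Q h
    (λ y y≢x y∈P → trans (cong (λ R → lookup R (suc y)) (sym eq′)) (lookup-⋂ᵣ⁺ s G (suc y) λ i →
      trans (sym (unshift-lookup x f (G i) y y≢x)) (P⊆ y y∈P i)))
    (λ x∈P → trans (cong (λ R → lookup R zero) (sym eq′)) (lookup-⋂ᵣ⁺ s G zero λ i →
      unshift-lookup-x x f (G i) (P⊆ x x∈P i))))
  where
  P⊆ : ∀ y → lookup P y ≡ true → ∀ i → lookup (unshift x f (G i)) (suc y) ≡ true
  P⊆ y y∈P = lookup-⋂ᵣ⁻ s (unshift x f ∘ G) (suc y) (trans (cong (λ R → lookup R (suc y)) eq) y∈P)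

shift-uniform : ∀ {n k} (x : Fin n) f → Uniform k f → Uniform k (shift x f)
shift-uniform x f uniform F F∈ = trans (sym (∣unshift∣ x f F F∈)) (uniform (unshift x f F) (unshift∈ x f F F∈))

Stable : ∀ {n} → Fin n → Family (suc n) → Set
Stable x f = ∀ F → f (false ∷ F) ≡ true → lookup F x ≡ true → f (true ∷ F [ x ]≔ false) ≡ true

shift-stable : ∀ {n} (x : Fin n) f → Stable x (shift x f)
shift-stable x f F F∈ x∈F rewrite x∈F with f (false ∷ F)
... | true rewrite F∈ = refl

compress : ∀ {n} → List (Fin n) → Family (suc n) → Family (suc n)
compress []       f = f
compress (x ∷ xs) f = compress xs (shift x f)

compress-preserves : ∀ {n} (P : Family (suc n) → Set) → (∀ x f → P f → P (shift x f)) →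
  ∀ xs f → P f → P (compress xs f)
compress-preserves P step []       f Pf = Pf
compress-preserves P step (x ∷ xs) f Pf = compress-preserves P step xs (shift x f) (step x f Pf)

∈⇒∈compress : ∀ {n} xs (f : Family (suc n)) F → f (true ∷ F) ≡ true → compress xs f (true ∷ F) ≡ true
∈⇒∈compress xs f F = compress-preserves (λ g → g (true ∷ F) ≡ true) (λ x g → ∈⇒∈shift x g F) xs f

∈compress⇒∈ : ∀ {n} xs (f : Family (suc n)) F → compress xs f (false ∷ F) ≡ true → f (false ∷ F) ≡ true
∈compress⇒∈ []       f F F∈ = F∈
∈compress⇒∈ (x ∷ xs) f F F∈ = ∈shift⇒∈ x f F (∈compress⇒∈ xs (shift x f) F F∈)

-- One pass suffices: sets containing the first element are never removed, others are never added.
compress-stable : ∀ {n} {xs} {x : Fin n} → x ∈ xs → ∀ f → Stable x (compress xs f)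
compress-stable {xs = x ∷ xs} (here refl) f F F∈ x∈F =
  ∈⇒∈compress xs (shift x f) _ (shift-stable x f F (∈compress⇒∈ xs (shift x f) F F∈) x∈F)
compress-stable {xs = y ∷ xs} (there x∈xs) f = compress-stable x∈xs (shift y f)

-- Splitting a shifted family at the first element

link-intersecting : ∀ {n s u} (f : Family (suc n)) → Intersecting s (suc u) f → Intersecting s u (f ∘ (true ∷_))
link-intersecting {s = s} {u} f int G G∈ =
  s≤s⁻¹ (subst (λ P → suc u ≤ ∣ P ∣) (⋂ᵣ-true∷ s G) (int (λ i → true ∷ G i) G∈))

empty-or-lookup : ∀ {n} (P : Subset n) → ∣ P ∣ ≡ 0 ⊎ ∃ λ x → lookup P x ≡ true
empty-or-lookup [] = inj₁ refl
empty-or-lookup (true ∷ P) = inj₂ (zero , refl)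
empty-or-lookup (false ∷ P) with empty-or-lookup P
... | inj₁ empty     = inj₁ empty
... | inj₂ (x , x∈P) = inj₂ (suc x , x∈P)

∩-[x]≔false : ∀ {n} x (P Q R : Subset n) → P ∩ (Q [ x ]≔ false) ∩ R ≡ (P ∩ Q ∩ R) [ x ]≔ false
∩-[x]≔false zero    (true  ∷ P) (b ∷ Q) (c ∷ R) = refl
∩-[x]≔false zero    (false ∷ P) (b ∷ Q) (c ∷ R) = refl
∩-[x]≔false (suc x) (a ∷ P) (b ∷ Q) (c ∷ R) = cong ((a ∧ b ∧ c) ∷_) (∩-[x]≔false x P Q R)

lookup-∩⁻ : ∀ {n} (P Q : Subset n) x → lookup (P ∩ Q) x ≡ true → lookup P x ≡ true × lookup Q x ≡ true
lookup-∩⁻ P Q x h rewrite lookup-zipWith _∧_ x P Q with lookup P x | lookup Q x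
... | true | true = refl , refl

tail-∩ : ∀ {n} (P Q : Subset (suc n)) → tail (P ∩ Q) ≡ tail P ∩ tail Q
tail-∩ (a ∷ P) (b ∷ Q) = refl

-- Each of the sets G i in turn is exchanged for a shifted one, which removes an element from the
-- intersection as long as it is non-empty.
shrink-intersection : ∀ {n} (f : Family (suc n)) → (∀ x → Stable x f) → ∀ r (P : Subset n) G →
  (∀ i → f (false ∷ G i) ≡ true) →
  ∃ λ (H : Fin r → Subset (suc n)) → (∀ i → f (H i) ≡ true) × ∣ P ∩ tail (⋂ᵣ r H) ∣ ≤ ∣ P ∩ ⋂ᵣ r G ∣ ∸ r
shrink-intersection f stable zero P G G∈ = (λ ()) , (λ ()) , ≤-refl
shrink-intersection {n} f stable (suc r) P G G∈
  with shrink-intersection f stable r (P ∩ G zero) (G ∘ suc) (G∈ ∘ suc)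
... | H , H∈ , ∣PGH∣≤ with empty-or-lookup (P ∩ G zero ∩ tail (⋂ᵣ r H))
...   | inj₁ empty = H′ , (λ { zero → G∈ zero ; (suc i) → H∈ i }) , (begin
  ∣ P ∩ tail ((false ∷ G zero) ∩ ⋂ᵣ r H) ∣  ≡⟨ cong (λ R → ∣ P ∩ R ∣) (tail-∩ (false ∷ G zero) (⋂ᵣ r H)) ⟩
  ∣ P ∩ G zero ∩ tail (⋂ᵣ r H) ∣            ≡⟨ empty ⟩
  0                                         ≤⟨ z≤n ⟩
  ∣ P ∩ G zero ∩ ⋂ᵣ r (G ∘ suc) ∣ ∸ suc r   ∎)
  where
  open ≤-Reasoning
  H′ : Fin (suc r) → Subset (suc n)
  H′ zero    = false ∷ G zero
  H′ (suc i) = H i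
...   | inj₂ (x , x∈) = H′ , (λ { zero → stable x (G zero) (G∈ zero) x∈G₀ ; (suc i) → H∈ i }) , s≤s⁻¹ (begin
  suc ∣ P ∩ tail ((true ∷ G zero [ x ]≔ false) ∩ ⋂ᵣ r H) ∣
    ≡⟨ cong (λ R → suc ∣ P ∩ R ∣) (tail-∩ (true ∷ G zero [ x ]≔ false) (⋂ᵣ r H)) ⟩
  suc ∣ P ∩ (G zero [ x ]≔ false) ∩ tail (⋂ᵣ r H) ∣     ≡⟨ cong (suc ∘ ∣_∣) (∩-[x]≔false x P (G zero) (tail (⋂ᵣ r H))) ⟩
  suc ∣ (P ∩ G zero ∩ tail (⋂ᵣ r H)) [ x ]≔ false ∣     ≡⟨ ∣[x]≔false∣ (P ∩ G zero ∩ tail (⋂ᵣ r H)) x x∈ ⟩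
  ∣ P ∩ G zero ∩ tail (⋂ᵣ r H) ∣                        ≤⟨ bound ⟩
  ∣ P ∩ G zero ∩ ⋂ᵣ r (G ∘ suc) ∣ ∸ r                   ≡⟨ m>0⇒m≡1+[m∸1] (≤-trans 1≤ bound) ⟩
  suc ((∣ P ∩ G zero ∩ ⋂ᵣ r (G ∘ suc) ∣ ∸ r) ∸ 1)       ≡⟨ cong suc (∸-+-assoc _ r 1) ⟩
  suc (∣ P ∩ G zero ∩ ⋂ᵣ r (G ∘ suc) ∣ ∸ (r + 1))       ≡⟨ cong (λ z → suc (∣ P ∩ G zero ∩ ⋂ᵣ r (G ∘ suc) ∣ ∸ z)) (+-comm r 1) ⟩
  suc (∣ P ∩ G zero ∩ ⋂ᵣ r (G ∘ suc) ∣ ∸ suc r)         ∎)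
  where
  open ≤-Reasoning
  H′ : Fin (suc r) → Subset (suc n)
  H′ zero    = true ∷ G zero [ x ]≔ false
  H′ (suc i) = H i
  x∈G₀ : lookup (G zero) x ≡ true
  x∈G₀ = proj₁ (lookup-∩⁻ (G zero) (tail (⋂ᵣ r H)) x (proj₂ (lookup-∩⁻ P _ x x∈)))
  bound : ∣ P ∩ G zero ∩ tail (⋂ᵣ r H) ∣ ≤ ∣ P ∩ G zero ∩ ⋂ᵣ r (G ∘ suc) ∣ ∸ r
  bound = subst₂ (λ Q R → ∣ Q ∣ ≤ ∣ R ∣ ∸ r) (∩-assoc P (G zero) _) (∩-assoc P (G zero) _) ∣PGH∣≤
  1≤ : 1 ≤ ∣ P ∩ G zero ∩ tail (⋂ᵣ r H) ∣
  1≤ = subst (1 ≤_) (∣[x]≔false∣ (P ∩ G zero ∩ tail (⋂ᵣ r H)) x x∈) (s≤s z≤n)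
  m>0⇒m≡1+[m∸1] : ∀ {m} → 1 ≤ m → m ≡ suc (m ∸ 1)
  m>0⇒m≡1+[m∸1] (s≤s _) = refl

-- One of the s = 1 + m sets is kept and the other m are exchanged. The first element, which the
-- exchange brings in, is missing from the kept set, so the intersection only shrinks; yet it must
-- retain u+1 elements.
deletion-intersecting : ∀ {n m u} (f : Family (suc n)) → (∀ x → Stable x f) →
  Intersecting (suc m) (suc u) f → Intersecting (suc m) (suc u + m) (f ∘ (false ∷_))
deletion-intersecting {n} {m} {u} f stable int G G∈
  with shrink-intersection f stable m (G zero) (G ∘ suc) (G∈ ∘ suc)
... | H , H∈ , ∣GH∣≤ = begin
  suc u + m                             ≤⟨ +-monoˡ-≤ m u<∣⋂G∣∸m ⟩
  -- The truncated difference is at least u+1, hence positive and a true difference.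
  (∣ ⋂ᵣ (suc m) G ∣ ∸ m) + m            ≡⟨ m∸n+n≡m (<⇒≤ (m∸n≢0⇒n<m {n = m} λ eq → contradiction (subst (suc u ≤_) eq u<∣⋂G∣∸m) λ ())) ⟩
  ∣ ⋂ᵣ (suc m) G ∣                      ∎
  where
  open ≤-Reasoning
  H′ : Fin (suc m) → Subset (suc n)
  H′ zero    = false ∷ G zero
  H′ (suc i) = H i
  ∣false∷∩∣ : ∀ {n} (P : Subset n) Q → ∣ (false ∷ P) ∩ Q ∣ ≡ ∣ P ∩ tail Q ∣
  ∣false∷∩∣ P (b ∷ Q) = refl
  u<∣⋂G∣∸m : suc u ≤ ∣ ⋂ᵣ (suc m) G ∣ ∸ m
  u<∣⋂G∣∸m = begin
    suc u                                 ≤⟨ int H′ (λ { zero → G∈ zero ; (suc i) → H∈ i }) ⟩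
    ∣ (false ∷ G zero) ∩ ⋂ᵣ m H ∣         ≡⟨ ∣false∷∩∣ (G zero) (⋂ᵣ m H) ⟩
    ∣ G zero ∩ tail (⋂ᵣ m H) ∣            ≤⟨ ∣GH∣≤ ⟩
    ∣ ⋂ᵣ (suc m) G ∣ ∸ m                  ∎

-- Counting intersecting families

-- The first inequality is 1/2 + x^s/2 ≤ x for x = (1+q)/(2q), cleared of denominators; the second
-- bounds what is left when the walk hits 0.
module _ (m q N₀ K₀ : ℕ) .{{_ : NonZero q}}
  ([1+q]^s≤2^s*q^m : suc q ^ suc m ≤ 2 ^ suc m * q ^ m)
  (binomial-bound : ∀ i n k → n + (2 + suc m * i) ≡ N₀ → k + (2 + m * i) ≡ K₀ →
    2 ^ (2 + suc m * i) * (n C k) ≤ N₀ C K₀)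
  where

  -- With s = 1 + m, the parameters n, k, d are those left after reading some elements, i of which
  -- were avoided; when d reaches 0, at most N₀ C K₀ / 2^(2+si) sets remain. The factor (1+q)/q is
  -- 2x, where 1/2 + x^s/2 ≤ x.
  intersecting-bound : ∀ n k d i (f : Family n) → Uniform k f → Intersecting (suc m) d f →
    n + (2 + suc m * i) ≡ N₀ + d → k + (2 + m * i) ≡ K₀ + d →
    size f * 2 ^ (2 + suc m * i) * q ^ d ≤ suc q ^ d * (N₀ C K₀)
  intersecting-bound n k zero i f uniform int n+ k+ = begin
    size f * w * 1       ≡⟨ trans (*-identityʳ (size f * w)) (*-comm (size f) w) ⟩
    w * size f           ≤⟨ *-monoʳ-≤ w (uniform⇒size≤nCk k f uniform) ⟩
    w * (n C k)          ≤⟨ binomial-bound i n k (trans n+ (+-identityʳ N₀)) (trans k+ (+-identityʳ K₀)) ⟩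
    N₀ C K₀              ≡⟨ *-identityˡ (N₀ C K₀) ⟨
    1 * (N₀ C K₀)        ∎
    where
    open ≤-Reasoning
    w = 2 ^ (2 + suc m * i)
  intersecting-bound zero k (suc d) i f uniform int n+ k+
    rewrite size-empty f (λ { [] []∈ → contradiction (intersecting⇒u≤∣F∣ {f = f} int [] []∈) λ () }) = z≤n
  intersecting-bound (suc n) zero (suc d) i f uniform int n+ k+
    rewrite size-empty f (λ F F∈ → contradiction (subst (suc d ≤_) (uniform F F∈) (intersecting⇒u≤∣F∣ {f = f} int F F∈)) λ ()) = z≤n
  intersecting-bound (suc n) (suc k) (suc d) i f uniform int n+ k+ = begin
    size f * w * q ^ suc d           ≡⟨ cong (λ z → z * w * q ^ suc d) size-g ⟨
    (a + b) * w * (q * q ^ d)        ≡⟨ regroup a b w q (q ^ d) ⟩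
    q * (a * w * q ^ d) + b * w * (q * q ^ d)
      -- Of the new factor 1+q, the sets containing the first element take the share q and those
      -- avoiding it the share 1.
      ≤⟨ +-mono-≤ (*-monoʳ-≤ q link-bound) deletion-bound ⟩
    q * (suc q ^ d * c) + suc q ^ d * c ≡⟨ collect q (suc q ^ d) c ⟩
    suc q ^ suc d * c                ∎
    where
    open ≤-Reasoning
    w = 2 ^ (2 + suc m * i)
    c = N₀ C K₀
    g = compress (allFin n) f
    a = size (g ∘ (true ∷_))
    b = size (g ∘ (false ∷_))
    size-g : size g ≡ size f
    size-g = compress-preserves (λ h → size h ≡ size f) (λ x h eq → trans (size-shift x h) eq) (allFin n) f refl
    g-uniform : Uniform (suc k) g
    g-uniform = compress-preserves (Uniform (suc k)) shift-uniform (allFin n) f uniform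
    g-int : Intersecting (suc m) (suc d) g
    g-int = compress-preserves (Intersecting (suc m) (suc d)) shift-intersecting (allFin n) f int
    regroup : ∀ a b w q x → (a + b) * w * (q * x) ≡ q * (a * w * x) + b * w * (q * x)
    regroup = solve-∀
    collect : ∀ q x c → q * (x * c) + x * c ≡ suc q * x * c
    collect = solve-∀
    link-bound : a * w * q ^ d ≤ suc q ^ d * c
    link-bound = intersecting-bound n k d i (g ∘ (true ∷_))
      (λ F F∈ → suc-injective (g-uniform (true ∷ F) F∈)) (link-intersecting g g-int)
      (suc-injective (trans n+ (+-suc N₀ d))) (suc-injective (trans k+ (+-suc K₀ d)))
    deletion-bound : b * w * (q * q ^ d) ≤ suc q ^ d * c
    -- The factor 2^s pays for raising `i` by one, and q^m for raising the intersection parameter by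
    -- m.
    deletion-bound = *-cancelʳ-≤ _ _ (2 ^ suc m * q ^ m) {{m*n≢0 (2 ^ suc m) (q ^ m) {{m^n≢0 2 (suc m)}} {{m^n≢0 q m}}}} (begin
      b * w * (q * q ^ d) * (2 ^ suc m * q ^ m)
        ≡⟨ shuffle b w (q * q ^ d) (2 ^ suc m) (q ^ m) ⟩
      b * (w * 2 ^ suc m) * (q * q ^ d * q ^ m)
        ≡⟨ cong₂ (λ y z → b * y * z)
             (trans (sym (^-distribˡ-+-* 2 (2 + suc m * i) (suc m))) (cong (2 ^_) (exponent m i)))
             (sym (^-distribˡ-+-* q (suc d) m)) ⟩
      b * 2 ^ (2 + suc m * suc i) * q ^ (suc d + m)
        ≤⟨ intersecting-bound n (suc k) (suc d + m) (suc i) (g ∘ (false ∷_)) (g-uniform ∘ (false ∷_))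
             (deletion-intersecting g (λ x → compress-stable (∈-allFin x) f) g-int)
             (trans (n-step n m i) (trans (cong (_+ m) n+) (+-assoc N₀ (suc d) m)))
             (trans (k-step (suc k) m i) (trans (cong (_+ m) k+) (+-assoc K₀ (suc d) m))) ⟩
      suc q ^ (suc d + m) * c
        ≡⟨ cong (_* c) (trans (cong (suc q ^_) (sym (+-suc d m))) (^-distribˡ-+-* (suc q) d (suc m))) ⟩
      suc q ^ d * suc q ^ suc m * c
        ≤⟨ *-monoˡ-≤ c (*-monoʳ-≤ (suc q ^ d) [1+q]^s≤2^s*q^m) ⟩
      suc q ^ d * (2 ^ suc m * q ^ m) * c
        ≡⟨ swap (suc q ^ d) (2 ^ suc m * q ^ m) c ⟩
      suc q ^ d * c * (2 ^ suc m * q ^ m) ∎)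
      where
      shuffle : ∀ b w x y z → b * w * x * (y * z) ≡ b * (w * y) * (x * z)
      shuffle = solve-∀
      exponent : ∀ m i → 2 + suc m * i + suc m ≡ 2 + suc m * suc i
      exponent = solve-∀
      n-step : ∀ n m i → n + (2 + suc m * suc i) ≡ suc n + (2 + suc m * i) + m
      n-step = solve-∀
      k-step : ∀ k m i → k + (2 + m * suc i) ≡ k + (2 + m * i) + m
      k-step = solve-∀
      swap : ∀ x y c → x * y * c ≡ x * c * y
      swap = solve-∀

-- Families as duplicate-free lists

remove : ∀ {n} → Subset n → Family n → Family n
remove []          f []          = false
remove (true  ∷ G) f (true  ∷ F) = remove G (f ∘ (true ∷_)) F
remove (true  ∷ G) f (false ∷ F) = f (false ∷ F)
remove (false ∷ G) f (true  ∷ F) = f (true ∷ F)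
remove (false ∷ G) f (false ∷ F) = remove G (f ∘ (false ∷_)) F

size-remove : ∀ {n} (G : Subset n) f → f G ≡ true → size f ≡ suc (size (remove G f))
size-remove []          f G∈ rewrite G∈ = refl
size-remove (true  ∷ G) f G∈ = cong (_+ size (f ∘ (false ∷_))) (size-remove G (f ∘ (true ∷_)) G∈)
size-remove (false ∷ G) f G∈ =
  trans (cong (size (f ∘ (true ∷_)) +_) (size-remove G (f ∘ (false ∷_)) G∈)) (+-suc _ _)

∈remove : ∀ {n} (G : Subset n) f F → G ≢ F → f F ≡ true → remove G f F ≡ true
∈remove []          f []          G≢F F∈ = contradiction refl G≢F
∈remove (true  ∷ G) f (true  ∷ F) G≢F F∈ = ∈remove G (f ∘ (true ∷_)) F (G≢F ∘ cong (true ∷_)) F∈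
∈remove (true  ∷ G) f (false ∷ F) G≢F F∈ = F∈
∈remove (false ∷ G) f (true  ∷ F) G≢F F∈ = F∈
∈remove (false ∷ G) f (false ∷ F) G≢F F∈ = ∈remove G (f ∘ (false ∷_)) F (G≢F ∘ cong (false ∷_)) F∈

-- Listed sets are removed from `f` one by one; as the list has no duplicates, the later ones
-- remain.
length≤size : ∀ {n} (f : Family n) 𝓕 → Unique 𝓕 → All (λ F → f F ≡ true) 𝓕 → length 𝓕 ≤ size f
length≤size f []      _             _          = z≤n
length≤size f (G ∷ 𝓕) (G≢ ∷ unique) (G∈ ∷ 𝓕⊆f) rewrite size-remove G f G∈ =
  s≤s (length≤size (remove G f) 𝓕 unique
    (All-zipWith (λ { {F} (G≢F , F∈) → ∈remove G f F G≢F F∈ }) (G≢ , 𝓕⊆f)))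

members : ∀ {n} → Family n → List (Subset n)
members {zero}  f = if f [] then [] ∷ [] else []
members {suc n} f = map (true ∷_) (members (f ∘ (true ∷_))) ++ map (false ∷_) (members (f ∘ (false ∷_)))

length-members : ∀ {n} (f : Family n) → length (members f) ≡ size f
length-members {zero} f with f []
... | true  = refl
... | false = refl
length-members {suc n} f = trans (length-++ (map (true ∷_) (members (f ∘ (true ∷_))))) (cong₂ _+_
  (trans (length-map (true ∷_) (members (f ∘ (true ∷_)))) (length-members (f ∘ (true ∷_))))
  (trans (length-map (false ∷_) (members (f ∘ (false ∷_)))) (length-members (f ∘ (false ∷_)))))

members-unique : ∀ {n} (f : Family n) → Unique (members f)
members-unique {zero} f with f []
... | true  = [] ∷ []
... | false = []
members-unique {suc n} f = Unique.++⁺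
  (Unique.map⁺ ∷-injectiveʳ (members-unique (f ∘ (true ∷_))))
  (Unique.map⁺ ∷-injectiveʳ (members-unique (f ∘ (false ∷_))))
  disjoint
  where
  disjoint : ∀ {F} → ¬ (F ∈ map (true ∷_) (members (f ∘ (true ∷_))) × F ∈ map (false ∷_) (members (f ∘ (false ∷_))))
  disjoint (F∈₁ , F∈₀) with ∈-map⁻ (true ∷_) F∈₁ | ∈-map⁻ (false ∷_) F∈₀
  ... | _ , _ , refl | _ , _ , ()

∈members⁻ : ∀ {n} (f : Family n) {F} → F ∈ members f → f F ≡ true
∈members⁻ {zero} f {[]} F∈ with f []
... | true = refl
∈members⁻ {zero} f {[]} () | false
∈members⁻ {suc n} f F∈ with ∈-++⁻ (map (true ∷_) (members (f ∘ (true ∷_)))) F∈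
... | inj₁ F∈₁ with ∈-map⁻ (true ∷_) F∈₁
...   | _ , G∈ , refl = ∈members⁻ (f ∘ (true ∷_)) G∈
∈members⁻ {suc n} f F∈ | inj₂ F∈₀ with ∈-map⁻ (false ∷_) F∈₀
...   | _ , G∈ , refl = ∈members⁻ (f ∘ (false ∷_)) G∈

_∈ᶠ?_ : ∀ {n} (F : Subset n) 𝓕 → Dec (F ∈ 𝓕)
_∈ᶠ?_ = DecMembership._∈?_
  where import Data.List.Membership.DecPropositional (≡-dec Bool._≟_) as DecMembership

does⇒ : ∀ {A : Set} (d : Dec A) → does d ≡ true → A
does⇒ (yes a) _ = a

-- Stars

inStar? : ∀ {n} (T : Subset n) k F → Dec (T ⊆ F × ∣ F ∣ ≡ k)
inStar? T k F = (T ⊆? F) ×-dec (∣ F ∣ ≟ k)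

star : ∀ {n} → Subset n → ℕ → Family n
star T k F = does (inStar? T k F)

star-empty : ∀ {n} (T : Subset n) k → k < ∣ T ∣ → size (star T k) ≡ 0
star-empty T k k<∣T∣ = size-empty (star T k) λ F F∈ → let T⊆F , ∣F∣≡k = does⇒ (inStar? T k F) F∈ in
  <⇒≱ k<∣T∣ (subst (∣ T ∣ ≤_) ∣F∣≡k (p⊆q⇒∣p∣≤∣q∣ T⊆F))

-- An element of `T` leaves one choice, and any other element gives Pascal's rule.
size-star : ∀ {n} (T : Subset n) j → size (star T (∣ T ∣ + j)) ≡ (n ∸ ∣ T ∣) C j
size-star [] zero    = refl
size-star [] (suc j) = refl
size-star (true ∷ T) j = trans
  (cong₂ _+_ (size-star T j) (size-empty (star (true ∷ T) (suc (∣ T ∣ + j)) ∘ (false ∷_)) λ F ()))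
  (+-identityʳ _)
size-star {suc n} (false ∷ T) zero = begin
  size (star (false ∷ T) (∣ T ∣ + 0) ∘ (true ∷_)) + size (star T (∣ T ∣ + 0))
    ≡⟨ cong₂ _+_ (size-empty (star (false ∷ T) (∣ T ∣ + 0) ∘ (true ∷_)) too-small) (size-star T 0) ⟩
  (n ∸ ∣ T ∣) C 0        ≡⟨ trans (nC0≡1 (n ∸ ∣ T ∣)) (sym (nC0≡1 (suc n ∸ ∣ T ∣))) ⟩
  (suc n ∸ ∣ T ∣) C 0    ∎
  where
  open ≡-Reasoning
  too-small : ∀ F → star (false ∷ T) (∣ T ∣ + 0) (true ∷ F) ≡ true → ⊥
  too-small F F∈ with does⇒ (inStar? (false ∷ T) (∣ T ∣ + 0) (true ∷ F)) F∈
  ... | T⊆F , ∣F∣≡ = <-irrefl refl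
    (≤-trans (≤-reflexive (trans ∣F∣≡ (+-identityʳ ∣ T ∣))) (p⊆q⇒∣p∣≤∣q∣ (drop-∷-⊆ T⊆F)))
size-star {suc n} (false ∷ T) (suc j) rewrite +-suc ∣ T ∣ j | +-∸-assoc 1 (∣p∣≤n T) = begin
  size (star T (∣ T ∣ + j)) + size (star T (suc (∣ T ∣ + j)))
    ≡⟨ cong₂ _+_ (size-star T j) (trans (cong (size ∘ star T) (sym (+-suc ∣ T ∣ j))) (size-star T (suc j))) ⟩
  (n ∸ ∣ T ∣) C j + (n ∸ ∣ T ∣) C suc j  ≡⟨ nCk+nC[k+1]≡[n+1]C[k+1] (n ∸ ∣ T ∣) j ⟩
  suc (n ∸ ∣ T ∣) C suc j                ∎
  where open ≡-Reasoning

starSize-≥ : ∀ n {k t} → t ≤ k → starSize n k t ≡ (n ∸ t) C (k ∸ t)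
starSize-≥ n {k} {t} t≤k with t ≤ᵇ k in eq
... | true  = refl
... | false = ⊥-elim (subst T eq (≤⇒≤ᵇ t≤k))

starSize-< : ∀ n {k t} → k < t → starSize n k t ≡ 0
starSize-< n {k} {t} k<t with t ≤ᵇ k in eq
... | true  = contradiction (≤ᵇ⇒≤ t k (subst T (sym eq) _)) (<⇒≱ k<t)
... | false = refl

size-star≡starSize : ∀ {n} (T : Subset n) k → size (star T k) ≡ starSize n k (∣ T ∣)
size-star≡starSize {n} T k with ≤-<-connex ∣ T ∣ k
... | inj₂ k<t = trans (star-empty T k k<t) (sym (starSize-< n k<t))
... | inj₁ t≤k = begin
  size (star T k)                          ≡⟨ cong (size ∘ star T) (m+[n∸m]≡n t≤k) ⟨
  size (star T (∣ T ∣ + (k ∸ ∣ T ∣)))      ≡⟨ size-star T (k ∸ ∣ T ∣) ⟩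
  (n ∸ ∣ T ∣) C (k ∸ ∣ T ∣)                ≡⟨ starSize-≥ n t≤k ⟨
  starSize n k (∣ T ∣)                       ∎
  where open ≡-Reasoning

subset-of-size : ∀ {n} (M : Subset n) t → t ≤ ∣ M ∣ → ∃ λ T → ∣ T ∣ ≡ t × T ⊆ M
subset-of-size {n} M zero _ = empty , ∣⊥∣≡0 n , ⊥⊆
subset-of-size (true ∷ M) (suc t) (s≤s t≤∣M∣) with subset-of-size M t t≤∣M∣
... | T , ∣T∣≡t , T⊆M = true ∷ T , cong suc ∣T∣≡t , s⊆s T⊆M
subset-of-size (false ∷ M) (suc t) t<∣M∣ with subset-of-size M (suc t) t<∣M∣
... | T , ∣T∣≡t , T⊆M = false ∷ T , ∣T∣≡t , out⊆ T⊆M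

⊆⋂ᵣ : ∀ {n} r {T : Subset n} (G : Fin r → Subset n) → (∀ i → T ⊆ G i) → T ⊆ ⋂ᵣ r G
⊆⋂ᵣ zero    G T⊆ _   = ∈⊤
⊆⋂ᵣ (suc r) G T⊆ x∈T = x∈p∩q⁺ (T⊆ zero x∈T , ⊆⋂ᵣ r (G ∘ suc) (T⊆ ∘ suc) x∈T)

starList : ∀ {n} (T : Subset n) k r → let 𝓢 = members (star T k) in
  IsFamily n k 𝓢 × RWiseTIntersecting r (∣ T ∣) 𝓢 × length 𝓢 ≡ starSize n k (∣ T ∣)
starList T k r =
  (members-unique (star T k) , All-tabulate λ F∈ → proj₂ (inStar F∈)) ,
  (λ G G∈ → p⊆q⇒∣p∣≤∣q∣ (⊆⋂ᵣ r G λ i → proj₁ (inStar (G∈ i)))) ,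
  trans (length-members (star T k)) (size-star≡starSize T k)
  where
  inStar : ∀ {F} → F ∈ members (star T k) → T ⊆ F × ∣ F ∣ ≡ k
  inStar {F} F∈ = does⇒ (inStar? T k F) (∈members⁻ (star T k) F∈)

module _ {n k : ℕ} (T : Subset n) where

  ⊆star⇒length≤starSize : ∀ 𝓕 → IsFamily n k 𝓕 → All (T ⊆_) 𝓕 → length 𝓕 ≤ starSize n k (∣ T ∣)
  ⊆star⇒length≤starSize 𝓕 (unique , uniform) T⊆ =
    subst (length 𝓕 ≤_) (size-star≡starSize T k) (length≤size (star T k) 𝓕 unique
      (All-zipWith (λ { {F} p → dec-true (inStar? T k F) p }) (T⊆ , uniform)))

  -- A set of the star missing from the list could be added to it, making it longer than a star.
  ⊆star∧length≡starSize⇒star : ∀ 𝓕 → IsFamily n k 𝓕 → All (T ⊆_) 𝓕 →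
    length 𝓕 ≡ starSize n k (∣ T ∣) → IsFullTStar k (∣ T ∣) 𝓕
  ⊆star∧length≡starSize⇒star 𝓕 (unique , uniform) T⊆ length≡ =
    T , refl , λ S → mk⇔ (λ S∈ → All-lookup uniform S∈ , λ {x} → All-lookup T⊆ S∈ {x}) (full-star S)
    where
    full-star : ∀ S → ∣ S ∣ ≡ k × T ⊆ S → S ∈ 𝓕
    full-star S (∣S∣≡k , T⊆S) with S ∈ᶠ? 𝓕
    ... | yes S∈ = S∈
    ... | no S∉  = contradiction
      (⊆star⇒length≤starSize (S ∷ 𝓕) (¬Any⇒All¬ 𝓕 S∉ ∷ unique , ∣S∣≡k ∷ uniform) ((λ {x} → T⊆S {x}) ∷ T⊆))
      (<⇒≱ (s≤s (≤-reflexive (sym length≡))))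

-- Non-trivial families

-- A finite list of all r-fold intersections, which makes it decidable whether each of them has more
-- than t elements and yields a witness if not.
meets : ∀ {n} → List (Subset n) → ℕ → List (Subset n)
meets 𝓕 zero    = full ∷ []
meets 𝓕 (suc r) = cartesianProductWith _∩_ 𝓕 (meets 𝓕 r)

⋂ᵣ∈meets : ∀ {n} (𝓕 : List (Subset n)) r (G : Fin r → Subset n) → (∀ i → G i ∈ 𝓕) → ⋂ᵣ r G ∈ meets 𝓕 r
⋂ᵣ∈meets 𝓕 zero    G G∈ = here refl
⋂ᵣ∈meets 𝓕 (suc r) G G∈ = ∈-cartesianProductWith⁺ _∩_ (G∈ zero) (⋂ᵣ∈meets 𝓕 r (G ∘ suc) (G∈ ∘ suc))

meets⇒⋂ᵣ : ∀ {n} (𝓕 : List (Subset n)) r {M} → M ∈ meets 𝓕 r →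
  ∃ λ (G : Fin r → Subset n) → (∀ i → G i ∈ 𝓕) × M ≡ ⋂ᵣ r G
meets⇒⋂ᵣ 𝓕 zero (here refl) = (λ ()) , (λ ()) , refl
meets⇒⋂ᵣ {n} 𝓕 (suc r) M∈ with ∈-cartesianProductWith⁻ _∩_ 𝓕 (meets 𝓕 r) M∈
... | F , M′ , F∈ , M′∈ , refl with meets⇒⋂ᵣ 𝓕 r M′∈
...   | G , G∈ , refl = G′ , (λ { zero → F∈ ; (suc i) → G∈ i }) , refl
  where
  G′ : Fin (suc r) → Subset n
  G′ zero    = F
  G′ (suc i) = G i

∣q∣≤∣p∩q∣⇒q⊆p : ∀ {n} (p q : Subset n) → ∣ q ∣ ≤ ∣ p ∩ q ∣ → q ⊆ p
∣q∣≤∣p∩q∣⇒q⊆p p q h {x} x∈q with x ∈? p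
... | yes x∈p = x∈p
... | no x∉p  = contradiction h
  (<⇒≱ (p⊂q⇒∣p∣<∣q∣ (p∩q⊆q p q , x , x∈q , λ x∈p∩q → x∉p (p∩q⊆p p q x∈p∩q))))

-- If r of the sets meet in only t elements, then every member contains their intersection.
common-subset-or-more-intersecting : ∀ {n} r t (𝓕 : List (Subset n)) → RWiseTIntersecting (2 + r) t 𝓕 →
  RWiseTIntersecting (1 + r) (1 + t) 𝓕 ⊎ (∃ λ M → t ≤ ∣ M ∣ × All (M ⊆_) 𝓕)
common-subset-or-more-intersecting {n} r t 𝓕 int with all? (λ M → suc t ≤? ∣ M ∣) (meets 𝓕 (suc r))
... | yes all = inj₁ λ G G∈ → All-lookup all (⋂ᵣ∈meets 𝓕 (suc r) G G∈)
... | no ¬all with find (¬All⇒Any¬ (λ M → suc t ≤? ∣ M ∣) (meets 𝓕 (suc r)) ¬all)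
...   | M , M∈ , ∣M∣≯t with meets⇒⋂ᵣ 𝓕 (suc r) M∈
...     | G , G∈ , refl = inj₂ (M , ≤-trans (t≤ (G∈ zero)) (∣p∩q∣≤∣q∣ (G zero) M) ,
  All-tabulate λ {F} F∈ → ∣q∣≤∣p∩q∣⇒q⊆p F M (≤-trans (≮⇒≥ ∣M∣≯t) (t≤ F∈)))
  where
  t≤ : ∀ {F} → F ∈ 𝓕 → t ≤ ∣ F ∩ M ∣
  t≤ {F} F∈ = int G′ λ { zero → F∈ ; (suc i) → G∈ i }
    where
    G′ : Fin (2 + r) → Subset n
    G′ zero    = F
    G′ (suc i) = G i

-- The walk starts from u = t + 2 with s = 3 + m, q = 2^(s-1) and no step up taken, which gives |F|
-- 4 q^u ≤ (1+q)^u C(n-t, k-t). The logarithmic hypothesis gives (1+q)^u < 4 q^u.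
intersecting-length<starSize : ∀ {n k t} m (𝓕 : List (Subset n)) → 1 ≤ t → t ≤ k → 2 * k ≤ n →
  LeMulLog2 (t + 2) (2 ^ (3 + m)) → IsFamily n k 𝓕 → RWiseTIntersecting (3 + m) (2 + t) 𝓕 →
  length 𝓕 < starSize n k t
intersecting-length<starSize {n} {k} {t} m 𝓕 1≤t t≤k 2k≤n log (unique , uniform) int =
  subst (length 𝓕 <_) (sym (starSize-≥ n t≤k)) (≤-<-trans
    (length≤size f 𝓕 unique (All-tabulate λ {F} F∈ → dec-true (F ∈ᶠ? 𝓕) F∈))
    (*-cancelʳ-< (4 * q ^ (2 + t)) _ _ (begin-strict
      size f * (4 * q ^ (2 + t))
        ≡⟨ *-assoc (size f) 4 (q ^ (2 + t)) ⟨
      size f * 4 * q ^ (2 + t)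
        ≡⟨ cong (λ z → size f * 2 ^ (2 + z) * q ^ (2 + t)) (*-zeroʳ (3 + m)) ⟨
      size f * 2 ^ (2 + (3 + m) * 0) * q ^ (2 + t)
        ≤⟨ intersecting-bound (2 + m) q N₀ K₀ {{m^n≢0 2 (2 + m)}} [1+q]^s≤2^s*q^m binomial-bound n k (2 + t) 0 f
             (λ F F∈ → All-lookup uniform (does⇒ (F ∈ᶠ? 𝓕) F∈))
             (λ G G∈ → int G λ i → does⇒ (G i ∈ᶠ? 𝓕) (G∈ i))
             (initial (3 + m) t≤n) (initial (2 + m) t≤k) ⟩
      suc q ^ (2 + t) * (N₀ C K₀)
        <⟨ *-monoˡ-< (N₀ C K₀) {{>-nonZero (nCk>0 K₀≤N₀)}} [1+q]^u<4q^u ⟩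
      4 * q ^ (2 + t) * (N₀ C K₀)
        ≡⟨ *-comm (4 * q ^ (2 + t)) (N₀ C K₀) ⟩
      (N₀ C K₀) * (4 * q ^ (2 + t)) ∎)))
  where
  open ≤-Reasoning
  q = 2 ^ (2 + m)
  N₀ = n ∸ t
  K₀ = k ∸ t
  f : Family n
  f F = does (F ∈ᶠ? 𝓕)
  k≤n : k ≤ n
  k≤n = ≤-trans (m≤m+n k (k + 0)) 2k≤n
  t≤n : t ≤ n
  t≤n = ≤-trans t≤k k≤n
  K₀≤N₀ : K₀ ≤ N₀
  K₀≤N₀ = ∸-monoˡ-≤ t k≤n
  [1+q]^u<4q^u : suc q ^ (2 + t) < 4 * q ^ (2 + t)
  [1+q]^u<4q^u = [1+q]^u<4*q^u q (2 + t) (m^n>0 2 (2 + m)) (s≤s z≤n)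
    (subst (λ u → LeMulLog2 u (2 ^ (3 + m))) (+-comm t 2) log)
  [1+q]^s≤2^s*q^m : suc q ^ (3 + m) ≤ 2 ^ (3 + m) * q ^ (2 + m)
  [1+q]^s≤2^s*q^m = ≤-trans ([1+2^s]^[1+s]≤2*[2^s]^[1+s] m) (≤-reflexive (sym (*-assoc 2 q (q ^ (2 + m)))))
  initial : ∀ c {x} → t ≤ x → x + (2 + c * 0) ≡ x ∸ t + (2 + t)
  initial c {x} t≤x = trans (cong (λ z → x + (2 + z)) (*-zeroʳ c))
    (trans (cong (_+ 2) (sym (m∸n+n≡m t≤x))) (regroup (x ∸ t) t))
    where
    regroup : ∀ y t → y + t + 2 ≡ y + (2 + t)
    regroup = solve-∀
  -- Subtracting t from n and 2t from 2k gains t ≥ 1, whence the strict inequality.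
  2K₀<N₀ : suc (2 * K₀) ≤ N₀
  2K₀<N₀ = +-cancelˡ-≤ t _ _ (begin
    t + suc (2 * K₀)       ≤⟨ +-monoʳ-≤ t (+-monoˡ-≤ (2 * K₀) 1≤t) ⟩
    t + (t + 2 * K₀)       ≡⟨ regroup t K₀ ⟩
    2 * (t + K₀)           ≡⟨ cong (2 *_) (m+[n∸m]≡n t≤k) ⟩
    2 * k                  ≤⟨ 2k≤n ⟩
    n                      ≡⟨ m+[n∸m]≡n t≤n ⟨
    t + N₀                 ∎)
    where
    regroup : ∀ t y → t + (t + 2 * y) ≡ 2 * (t + y)
    regroup = solve-∀
  -- Here a = 2 + (s-1)i and b = i. Since s ≥ 3, the surplus a - 2b = 2 + mi is non-negative.
  binomial-bound : ∀ i n k → n + (2 + (3 + m) * i) ≡ N₀ → k + (2 + (2 + m) * i) ≡ K₀ →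
    2 ^ (2 + (3 + m) * i) * (n C k) ≤ N₀ C K₀
  binomial-bound i n k n+ k+ = subst₂ (λ N K → 2 ^ (2 + (3 + m) * i) * (n C k) ≤ N C K) N≡ K≡
    (subst (λ z → 2 ^ z * (n C k) ≤ (2 + (2 + m) * i + i + n) C (2 + (2 + m) * i + k)) (exponent m i)
      (2^[a+b]*nCk≤[n+a+b]C[k+a] (2 + m * i) i (surplus m i) n k
        (subst₂ (λ N K → suc (2 * K) ≤ N) (sym N≡) (sym K≡) 2K₀<N₀)))
    where
    exponent : ∀ m i → 2 + (2 + m) * i + i ≡ 2 + (3 + m) * i
    exponent = solve-∀
    surplus : ∀ m i → 2 + (2 + m) * i ≡ 2 * i + (2 + m * i)
    surplus = solve-∀
    N≡ : 2 + (2 + m) * i + i + n ≡ N₀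
    N≡ = trans (trans (cong (_+ n) (exponent m i)) (+-comm _ n)) n+
    K≡ : 2 + (2 + m) * i + k ≡ K₀
    K≡ = trans (+-comm _ k) k+

-- e^3 > 2^4
LeMulLog2⇒3≤ : ∀ {a s} → 3 ≤ a → LeMulLog2 a (2 ^ s) → 3 ≤ s
LeMulLog2⇒3≤ {a} {s} 3≤a h = ≮⇒≥ λ s<3 → contradiction
  (begin
    expSum 3 4             ≤⟨ expSum-mono-≤ 3≤a 4 ⟩
    expSum a 4             ≤⟨ h 4 ⟩
    2 ^ (2 ^ s) * 4 !      ≤⟨ *-monoˡ-≤ (4 !) (^-monoʳ-≤ 2 (^-monoʳ-≤ 2 (s≤s⁻¹ s<3))) ⟩
    2 ^ (2 ^ 2) * 4 !      ∎)
  (<⇒≱ (≤ᵇ⇒≤ 385 393 _))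
  where open ≤-Reasoning

-- Families with a common t-set, and all others

-- The logarithmic hypothesis forces r ≥ 5. Without a common set, (r, t) becomes (r-1, t+1) and then
-- (r-2, t+2), where the count applies with s = r - 2 ≥ 3.
common-subset-or-length<starSize : ∀ {n k r t} (𝓕 : List (Subset n)) → 2 ≤ r → 1 ≤ t → t ≤ k → 2 * k ≤ n →
  LeMulLog2 (t + 2) (2 ^ (r ∸ 2)) → IsFamily n k 𝓕 → RWiseTIntersecting r t 𝓕 →
  (∃ λ M → t ≤ ∣ M ∣ × All (M ⊆_) 𝓕) ⊎ length 𝓕 < starSize n k t
common-subset-or-length<starSize {r = suc (suc s)} {t} 𝓕 (s≤s (s≤s z≤n)) 1≤t t≤k 2k≤n log fam int
  with LeMulLog2⇒3≤ {s = s} (+-monoˡ-≤ 2 1≤t) log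
... | s≤s (s≤s (s≤s {n = m} z≤n))
  with common-subset-or-more-intersecting (3 + m) t 𝓕 int
... | inj₂ common = inj₁ common
... | inj₁ int′ with common-subset-or-more-intersecting (2 + m) (1 + t) 𝓕 int′
...   | inj₂ (M , t<∣M∣ , M⊆) = inj₁ (M , <⇒≤ t<∣M∣ , M⊆)
...   | inj₁ int″ = inj₂ (intersecting-length<starSize m 𝓕 1≤t t≤k 2k≤n log fam int″)

common-subset-of-size-or-length<starSize : ∀ {n k r t} (𝓕 : List (Subset n)) → 2 ≤ r → 1 ≤ t → t ≤ n → 2 * k ≤ n →
  LeMulLog2 (t + 2) (2 ^ (r ∸ 2)) → IsFamily n k 𝓕 → RWiseTIntersecting r t 𝓕 →
  (∃ λ T → ∣ T ∣ ≡ t × All (T ⊆_) 𝓕) ⊎ length 𝓕 < starSize n k t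
common-subset-of-size-or-length<starSize {n} {k} {suc r} {t} 𝓕 2≤r 1≤t t≤n 2k≤n log fam int with ≤-<-connex t k
-- No set of k < t elements can be a member, so the family is empty and any t-set is vacuously
-- common.
... | inj₂ k<t = let T , ∣T∣≡t , _ = subset-of-size full t (subst (t ≤_) (sym (∣⊤∣≡n n)) t≤n) in
  inj₁ (T , ∣T∣≡t , All-tabulate λ {F} F∈ → contradiction
    (≤-trans (int (λ _ → F) (λ _ → F∈)) (∣p∩q∣≤∣p∣ F (⋂ᵣ r λ _ → F)))
    (<⇒≱ (subst (_< t) (sym (All-lookup (proj₂ fam) F∈)) k<t)))
... | inj₁ t≤k with common-subset-or-length<starSize 𝓕 2≤r 1≤t t≤k 2k≤n log fam int
...   | inj₂ small = inj₂ small
...   | inj₁ (M , t≤∣M∣ , M⊆) = let T , ∣T∣≡t , T⊆M = subset-of-size M t t≤∣M∣ in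
  inj₁ (T , ∣T∣≡t , All-map (λ M⊆F {x} x∈T → M⊆F (T⊆M x∈T)) M⊆)

theorem1p6 : (n k r t : ℕ) → 2 ≤ r → 1 ≤ t → 1 ≤ n → 1 ≤ k
    → 2 * k ≤ n
    → 2 * t ≤ n + 1
    → LeMulLog2 (t * (t ∸ 1)) (2 * (n + 1 ∸ 2 * t))
    → LeMulLog2 (t + 2) (2 ^ (r ∸ 2))
    → IsMaxSize n k r t (starSize n k t)
    × ((𝓕 : List (Subset n)) → IsFamily n k 𝓕 → RWiseTIntersecting r t 𝓕
    → length 𝓕 ≡ starSize n k t → IsFullTStar k t 𝓕)
theorem1p6 n k r t 2≤r 1≤t 1≤n 1≤k 2k≤n 2t≤n+1 _ log = (attained , bound) , extremal
  where
  t≤n : t ≤ n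
  t≤n = +-cancelˡ-≤ 1 t n (≤-trans (+-monoˡ-≤ t 1≤t) (subst₂ _≤_ (cong (t +_) (+-identityʳ t)) (+-comm n 1) 2t≤n+1))

  attained : ∃ λ (𝓕 : List (Subset n)) → IsFamily n k 𝓕 × RWiseTIntersecting r t 𝓕 × length 𝓕 ≡ starSize n k t
  -- Taking `T` inside the ground set also covers k < t, where the star is empty and `starSize` is
  -- 0.
  attained with subset-of-size (full {n}) t (subst (t ≤_) (sym (∣⊤∣≡n n)) t≤n)
  ... | T , refl , _ = members (star T k) , starList T k r

  bound : (𝓕 : List (Subset n)) → IsFamily n k 𝓕 → RWiseTIntersecting r t 𝓕 → length 𝓕 ≤ starSize n k t
  bound 𝓕 fam int with common-subset-of-size-or-length<starSize 𝓕 2≤r 1≤t t≤n 2k≤n log fam int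
  ... | inj₁ (T , refl , T⊆) = ⊆star⇒length≤starSize T 𝓕 fam T⊆
  ... | inj₂ small           = <⇒≤ small

  extremal : (𝓕 : List (Subset n)) → IsFamily n k 𝓕 → RWiseTIntersecting r t 𝓕 →
    length 𝓕 ≡ starSize n k t → IsFullTStar k t 𝓕
  extremal 𝓕 fam int length≡ with common-subset-of-size-or-length<starSize 𝓕 2≤r 1≤t t≤n 2k≤n log fam int
  ... | inj₁ (T , refl , T⊆) = ⊆star∧length≡starSize⇒star T 𝓕 fam T⊆ length≡
  ... | inj₂ small           = contradiction length≡ (<⇒≢ small)
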